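{- Let $f(x)\in \mathbb{Z}[x]$ be a polynomial of degree $d\geq 2$ with positive leading coefficient and having at least two distinct roots over an algebraic closure $\overline{\mathbb{Q}}$ of $\mathbb{Q}$, let $m\in \mathbb{Z}_{\geq 2}$, and put $F(x)=f(x)^m$. Then the set of lattice points in $\mathbb{Z}_{>0}\times\mathbb{Z}_{>0}$ that are visible along $F(x)$ has density $1$, i.e. $$D(F)=\lim_{N\to\infty}\frac{\#\{(a,h)\in\mathbb{Z}_{>0}^2:\max\{a,h\}\le N \text{ and } (a,h) \text{ is visible along } F\}}{N^2}=1.$$
   Context: For $F(x)\in\mathbb{Z}[x]$ with positive leading coefficient, a lattice point $(a,h)\in\mathbb{Z}_{>0}\times\mathbb{Z}_{>0}$ is called visible along $F(x)$ if there exists a rational number $t\in\mathbb{Q}$ such that $h=t\,F(a)$ and $a$ is the smallest positive integer $u$ such that $t\,F(u)$ is a positive integer; otherwise it is called invisible along $F(x)$. -}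

module Defs where

open import Data.Nat as ℕ using (ℕ; zero; suc)
open import Data.Integer as ℤ using (ℤ; +_)
open import Data.Rational as ℚ using (ℚ; 0ℚ; 1ℚ)
open import Data.List using (List; []; _∷_; length; last; map; upTo)
open import Data.Nat.ListAction using (sum)
open import Data.Maybe using (just)
open import Data.Product using (Σ; _×_; ∃; ∃-syntax)
open import Relation.Binary.PropositionalEquality using (_≡_)
open import Relation.Nullary using (¬_; Dec; yes; no)

-- A polynomial in ℤ[x] as its coefficient list, lowest degree first:
-- [c₀, c₁, …, c_d] represents c₀ + c₁ x + … + c_d x^d.
Poly : Set
Poly = List ℤ

evalℤ : Poly → ℤ → ℤ
evalℤ []       x = + 0
evalℤ (c ∷ cs) x = c ℤ.+ x ℤ.* evalℤ cs x

evalℚ : Poly → ℚ → ℚ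
evalℚ []       x = 0ℚ
evalℚ (c ∷ cs) x = (c ℚ./ 1) ℚ.+ x ℚ.* evalℚ cs x

_^ℚ_ : ℚ → ℕ → ℚ
q ^ℚ zero    = 1ℚ
q ^ℚ (suc n) = q ℚ.* (q ^ℚ n)

HasDegreeAndLC : Poly → ℕ → ℤ → Set
HasDegreeAndLC f d lc = (length f ≡ suc d) × (last f ≡ just lc) × (+ 0 ℤ.< lc)

-- f (of degree d, leading coefficient lc) has only ONE distinct root over ℚ̄:
-- f = lc·(x − r)^d for some r.  For f ∈ ℤ[x] such an r is necessarily rational
-- (r = −c_{d−1}/(d·lc)), and two polynomials over ℚ agree iff they agree on all of ℚ.
HasSingleRoot : Poly → ℕ → ℤ → Set
HasSingleRoot f d lc =
  ∃[ r ] ((x : ℚ) → evalℚ f x ≡ (lc ℚ./ 1) ℚ.* ((x ℚ.- r) ^ℚ d))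

IsPosInt : ℚ → Set
IsPosInt q = ∃[ n ] (q ≡ (+ suc n) ℚ./ 1)

VisibleAlong : (ℤ → ℤ) → ℕ → ℕ → Set
VisibleAlong F a h =
  Σ ℚ λ t →
    ((+ h) ℚ./ 1 ≡ t ℚ.* (F (+ a) ℚ./ 1))
    × IsPosInt (t ℚ.* (F (+ a) ℚ./ 1))
    × ((u : ℕ) → 0 ℕ.< u → u ℕ.< a → ¬ IsPosInt (t ℚ.* (F (+ u) ℚ./ 1)))

-- Counting with respect to a given decision procedure for visibility
-- (the count does not depend on which procedure is used).
count : (P : ℕ → ℕ → Set) → (∀ a h → Dec (P a h)) → ℕ → ℕ
count P dec N = sum (map (λ i → sum (map (λ j → ind (dec (suc i) (suc j))) (upTo N))) (upTo N))
  where
  ind : ∀ {A : Set} → Dec A → ℕ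
  ind (yes _) = 1
  ind (no _)  = 0

-- #{(a,h) ∈ [1,N]² visible} / N², for N = suc n.
ratio : (P : ℕ → ℕ → Set) → (∀ a h → Dec (P a h)) → ℕ → ℚ
ratio P dec n = (+ count P dec (suc n)) ℚ./ (suc n ℕ.* suc n)

HasDensity : (P : ℕ → ℕ → Set) → (∀ a h → Dec (P a h)) → ℚ → Set
HasDensity P dec L =
  (ε : ℚ) → 0ℚ ℚ.< ε → ∃[ N₀ ] ((n : ℕ) → N₀ ℕ.≤ n → ℚ.∣ ratio P dec n ℚ.- L ∣ ℚ.< ε)

{-# OPTIONS --safe #-}
module Submission where

-- Invisibility of (a , h) produces some 0 < u < a such that, writing f(u)/f(a) = j/k in lowest terms,
-- k ≥ 2 and k^m divides h. Cells where h has a square divisor k² with k > K have density at most 1/K.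
-- For each of the finitely many j/k with k ≤ K, the a with k f(u) = j f(a) solvable in u are sparse:
-- after completing the d-th power, u = α a + β + O(1/a) with α = (j/k)^(1/d), so two solutions at a
-- bounded distance p, far out, force α = q/p rational and (a , u) to lie exactly on the line of slope α.
-- Then all roots of f would be fixed by an affine contraction, unless the coordinates are bounded.

open import Defs
open import Data.Nat as ℕ using (ℕ; zero; suc; z≤n; s≤s; NonZero; _≤_)
import Data.Nat.Properties as ℕₚ
open import Data.Nat.ListAction using (sum)
open import Data.Nat.ListAction.Properties using (sum-++)
open import Data.Nat.DivMod using (_/_; m/n*n≡m)
open import Data.Nat.GCD using (gcd; gcd[m,n]∣m; gcd[m,n]∣n; gcd[m,n]≢0)
open import Data.Nat.Coprimality as Coprime using (Coprime; coprime-divisor; coprime-/gcd; 1-coprimeTo)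
open import Data.Nat.Tactic.RingSolver using () renaming (solve-∀ to ℕ-solve-∀)
import Data.Integer.Properties as ℤₚ
open import Data.Integer.Tactic.RingSolver using () renaming (solve-∀ to ℤ-solve-∀)
open import Data.Rational as ℚ using (ℚ; 0ℚ; 1ℚ; toℚᵘ; mkℚ)
import Data.Rational.Properties as ℚₚ
open import Data.Rational.Solver using (module +-*-Solver)
open import Data.Rational.Unnormalised as ℚᵘ using (mkℚᵘ; *≡*; *<*)
import Data.Rational.Unnormalised.Properties as ℚᵘₚ
open import Data.List using ([]; _∷_; _∷ʳ_; length; last; map; upTo)
open import Data.List.Properties using (map-++; map-cong; upTo-∷ʳ)
open import Data.List.Relation.Unary.All using (All; []; _∷_)
open import Data.Maybe using (just)
open import Data.Product using (_×_; _,_; ∃-syntax; Σ; proj₁; proj₂)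
open import Data.Sum as Sum using (_⊎_; inj₁; inj₂; [_,_]′)
open import Data.Empty using (⊥; ⊥-elim)
open import Relation.Nullary using (¬_; Dec; yes; no)
open import Relation.Nullary.Decidable using (_×-dec_)
open import Relation.Binary.PropositionalEquality

-- For a fixed j/k the exceptional columns need not be finite in number: f = x² - 1 with j/k = 1/2
-- leads to the Pell equation 2u² - a² = 1. Hence the aim is spacing: beyond some point two such
-- columns differ by at least any prescribed `gap`. The exponent m ≥ 2 enters through the
-- convergence of the sum of 1/k². The number α, in general irrational, never appears. Every
-- estimate compares d-th powers of natural numbers, and each conclusion comes from a natural number
-- shown to be less than 1. Completing the d-th power leaves a relative error O(1/W²), just small
-- enough to keep the determinant of two nearby solutions bounded. For even m, F(u) is positive also
-- where f(u) is negative, so the equations relate absolute values; signs have to be recovered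
-- before leading terms can be cancelled.

-- Differences of d-th powers of natural numbers

module PowerEstimates where

  open import Data.Nat
  open import Data.Nat.Properties

  ^-distribʳ-* : ∀ x y n → (x * y) ^ n ≡ x ^ n * y ^ n
  ^-distribʳ-* x y zero    = refl
  ^-distribʳ-* x y (suc n) =
    trans (cong (x * y *_) (^-distribʳ-* x y n)) (interchange x y (x ^ n) (y ^ n))
    where
    interchange : ∀ a b c d → a * b * (c * d) ≡ a * c * (b * d)
    interchange = ℕ-solve-∀

  1≤^ : ∀ {x} n → 1 ≤ x → 1 ≤ x ^ n
  1≤^ {x} n 1≤x = m^n>0 x {{>-nonZero 1≤x}} n

  ^-cancelˡ-≤ : ∀ n {x y} → x ^ suc n ≤ y ^ suc n → x ≤ y
  ^-cancelˡ-≤ n x^n≤y^n = ≮⇒≥ λ y<x → <⇒≱ (^-monoˡ-< (suc n) y<x) x^n≤y^n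

  -- Divided by ∣ x - y ∣, the right side is a sum of monomials in x and y, one of which is x ^ p.
  -- This replaces taking roots: closeness of powers becomes closeness of bases.
  ∣m-n∣*m^p≤∣m^[1+p]-n^[1+p]∣ : ∀ x y p → ∣ x - y ∣ * x ^ p ≤ ∣ x ^ suc p - y ^ suc p ∣
  ∣m-n∣*m^p≤∣m^[1+p]-n^[1+p]∣ x y p with ≤-total x y
  ... | inj₁ x≤y with z , refl ← m≤n⇒∃[o]m+o≡n x≤y = begin
    ∣ x - x + z ∣ * x ^ p                         ≡⟨ cong (_* x ^ p) (∣m-m+n∣≡n x z) ⟩
    z * x ^ p                                     ≤⟨ *-monoʳ-≤ z (^-monoˡ-≤ p (m≤m+n x z)) ⟩
    z * (x + z) ^ p                               ≤⟨ m≤n+m _ _ ⟩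
    (x * (x + z) ^ p ∸ x * x ^ p) + z * (x + z) ^ p
      ≡⟨ +-∸-comm _ (*-monoʳ-≤ x (^-monoˡ-≤ p (m≤m+n x z))) ⟨
    x * (x + z) ^ p + z * (x + z) ^ p ∸ x ^ suc p ≡⟨ cong (_∸ x ^ suc p) (*-distribʳ-+ ((x + z) ^ p) x z) ⟨
    (x + z) ^ suc p ∸ x ^ suc p                   ≤⟨ m∸n≤∣m-n∣ ((x + z) ^ suc p) (x ^ suc p) ⟩
    ∣ (x + z) ^ suc p - x ^ suc p ∣               ≡⟨ ∣-∣-comm _ (x ^ suc p) ⟩
    ∣ x ^ suc p - (x + z) ^ suc p ∣               ∎
    where open ≤-Reasoning
  ... | inj₂ y≤x with z , refl ← m≤n⇒∃[o]m+o≡n y≤x = begin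
    ∣ y + z - y ∣ * (y + z) ^ p                   ≡⟨ cong (_* (y + z) ^ p) (trans (∣-∣-comm (y + z) y) (∣m-m+n∣≡n y z)) ⟩
    z * (y + z) ^ p                               ≤⟨ m≤n+m _ _ ⟩
    (y * (y + z) ^ p ∸ y * y ^ p) + z * (y + z) ^ p
      ≡⟨ +-∸-comm _ (*-monoʳ-≤ y (^-monoˡ-≤ p (m≤m+n y z))) ⟨
    y * (y + z) ^ p + z * (y + z) ^ p ∸ y ^ suc p ≡⟨ cong (_∸ y ^ suc p) (*-distribʳ-+ ((y + z) ^ p) y z) ⟨
    (y + z) ^ suc p ∸ y ^ suc p                   ≤⟨ m∸n≤∣m-n∣ ((y + z) ^ suc p) (y ^ suc p) ⟩
    ∣ (y + z) ^ suc p - y ^ suc p ∣               ∎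
    where open ≤-Reasoning

  -- The converse estimate, a discrete mean value theorem: the same quotient has p + 1 monomials,
  -- each at most M ^ p.
  ∣m^[1+p]-n^[1+p]∣≤ : ∀ p {x y M} → x ≤ M → y ≤ M → ∣ x ^ suc p - y ^ suc p ∣ ≤ ∣ x - y ∣ * (suc p * M ^ p)
  ∣m^[1+p]-n^[1+p]∣≤ zero    {x} {y}     x≤M y≤M =
    ≤-reflexive (trans (cong₂ ∣_-_∣ (*-identityʳ x) (*-identityʳ y)) (sym (*-identityʳ _)))
  ∣m^[1+p]-n^[1+p]∣≤ (suc p) {x} {y} {M} x≤M y≤M = begin
    ∣ x * x ^ suc p - y * y ^ suc p ∣
      ≤⟨ ∣-∣-triangle (x * x ^ suc p) (x * y ^ suc p) (y * y ^ suc p) ⟩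
    ∣ x * x ^ suc p - x * y ^ suc p ∣ + ∣ x * y ^ suc p - y * y ^ suc p ∣
      ≡⟨ cong₂ _+_ (*-distribˡ-∣-∣ x _ _) (*-distribʳ-∣-∣ (y ^ suc p) x y) ⟨
    x * ∣ x ^ suc p - y ^ suc p ∣ + ∣ x - y ∣ * y ^ suc p
      ≤⟨ +-mono-≤ (*-mono-≤ x≤M (∣m^[1+p]-n^[1+p]∣≤ p x≤M y≤M)) (*-monoʳ-≤ ∣ x - y ∣ (^-monoˡ-≤ (suc p) y≤M)) ⟩
    M * (∣ x - y ∣ * (suc p * M ^ p)) + ∣ x - y ∣ * M ^ suc p
      ≡⟨ collect M ∣ x - y ∣ p (M ^ p) ⟩
    ∣ x - y ∣ * (suc (suc p) * M ^ suc p) ∎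
    where
    open ≤-Reasoning
    collect : ∀ M δ p m → M * (δ * ((1 + p) * m)) + δ * (M * m) ≡ δ * ((2 + p) * (M * m))
    collect = ℕ-solve-∀

  -- If k uᵈ ≈ j wᵈ with d = n + 2 and error O(wⁿ), then u/w = (j/k)^(1/d) + O(1/w²), so that for two
  -- such pairs (u , w) and (u + q , w + p) with p bounded, q/p → (j/k)^(1/d) and p u − q w → 0.
  module PowerGap (n K p̄ C : ℕ) where

    -- With y = w + p and u′ = u + q: `c` bounds w / u, `C₂` the determinant u y - u′ w, `C₃` the
    -- product of w with ∣ k qᵈ - j pᵈ ∣, and `C₄` the product of w with ∣ p u - q w ∣. Since w
    -- exceeds `C₃` and `C₄`, the last two differences vanish.
    d c C₂ C₃ C₄ threshold : ℕ
    d  = 2 + n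
    c  = 2 * K
    C₂ = 2 * C * (2 * c) ^ suc n
    C₃ = K * (C₂ * (d * (p̄ + C₂) ^ suc n)) + p̄ ^ d * C
    C₄ = c ^ suc n * (p̄ ^ d * C)
    threshold = suc (2 * C + p̄ + c * C₂ + C₃ + C₄)

    module _ {k j w} (k≤K : k ≤ K) (1≤k : 1 ≤ k) (1≤j : 1 ≤ j) (threshold≤w : threshold ≤ w) where

      w>C₄ : C₄ < w
      w>C₄ = ≤-<-trans (m≤n+m C₄ (2 * C + p̄ + c * C₂ + C₃)) threshold≤w

      w>C₃ : C₃ < w
      w>C₃ = ≤-<-trans (m≤n+m C₃ (2 * C + p̄ + c * C₂)) (≤-<-trans (m≤m+n _ C₄) threshold≤w)

      w>2C+p̄+cC₂ : 2 * C + p̄ + c * C₂ < w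
      w>2C+p̄+cC₂ = ≤-<-trans (m≤m+n _ C₃) (≤-<-trans (m≤m+n _ C₄) threshold≤w)

      w>cC₂ : c * C₂ < w
      w>cC₂ = ≤-<-trans (m≤n+m (c * C₂) (2 * C + p̄)) w>2C+p̄+cC₂

      w≥p̄ : p̄ ≤ w
      w≥p̄ = ≤-trans (m≤n+m p̄ (2 * C)) (≤-trans (m≤m+n _ (c * C₂)) (<⇒≤ w>2C+p̄+cC₂))

      w≥2C : 2 * C ≤ w
      w≥2C = ≤-trans (m≤m+n _ p̄) (≤-trans (m≤m+n _ (c * C₂)) (<⇒≤ w>2C+p̄+cC₂))

      1≤w : 1 ≤ w
      1≤w = ≤-trans (s≤s z≤n) threshold≤w

      -- Because j ≥ 1, wᵈ is at most k uᵈ plus the error, and w ≥ 2 C makes that error at most half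
      -- of wᵈ. So wᵈ ≤ 2 k uᵈ.
      w≤cu : ∀ {u} → ∣ k * u ^ d - j * w ^ d ∣ ≤ C * w ^ n → w ≤ c * u
      w≤cu {u} close = ^-cancelˡ-≤ (suc n) (begin
        w ^ d              ≤⟨ +-cancelʳ-≤ (w ^ d) (w ^ d) (2 * (k * u ^ d)) doubled ⟩
        2 * (k * u ^ d)    ≡⟨ *-assoc 2 k (u ^ d) ⟨
        2 * k * u ^ d      ≤⟨ *-monoˡ-≤ (u ^ d) (*-monoʳ-≤ 2 k≤K) ⟩
        c * u ^ d          ≤⟨ *-monoˡ-≤ (u ^ d) (m≤m*n c (c ^ suc n) {{>-nonZero (1≤^ (suc n) 1≤c)}}) ⟩
        c ^ d * u ^ d      ≡⟨ ^-distribʳ-* c u d ⟨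
        (c * u) ^ d        ∎)
        where
        open ≤-Reasoning
        1≤c : 1 ≤ c
        1≤c = *-mono-≤ {1} {2} (s≤s z≤n) (≤-trans 1≤k k≤K)
        regroup : ∀ a C e → a + C * e + (a + C * e) ≡ 2 * a + 2 * C * e
        regroup = ℕ-solve-∀
        below : w ^ d ≤ k * u ^ d + C * w ^ n
        below = begin
          w ^ d                                      ≤⟨ m≤n*m (w ^ d) j {{>-nonZero 1≤j}} ⟩
          j * w ^ d                                  ≤⟨ m≤n+∣n-m∣ _ (k * u ^ d) ⟩
          k * u ^ d + ∣ k * u ^ d - j * w ^ d ∣      ≤⟨ +-monoʳ-≤ (k * u ^ d) close ⟩
          k * u ^ d + C * w ^ n                      ∎
        doubled : w ^ d + w ^ d ≤ 2 * (k * u ^ d) + w ^ d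
        doubled = begin
          w ^ d + w ^ d                              ≤⟨ +-mono-≤ below below ⟩
          k * u ^ d + C * w ^ n + (k * u ^ d + C * w ^ n) ≡⟨ regroup (k * u ^ d) C (w ^ n) ⟩
          2 * (k * u ^ d) + 2 * C * w ^ n            ≤⟨ +-monoʳ-≤ (2 * (k * u ^ d)) (*-monoˡ-≤ (w ^ n) w≥2C) ⟩
          2 * (k * u ^ d) + w * w ^ n                ≤⟨ +-monoʳ-≤ (2 * (k * u ^ d)) (m≤n*m (w * w ^ n) w {{>-nonZero 1≤w}}) ⟩
          2 * (k * u ^ d) + w ^ d                    ∎

      module _ {u u′ p} (1≤p : 1 ≤ p) (p≤p̄ : p ≤ p̄)
               (close  : ∣ k * u ^ d - j * w ^ d ∣ ≤ C * w ^ n)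
               (close′ : ∣ k * u′ ^ d - j * (w + p) ^ d ∣ ≤ C * (w + p) ^ n)
               (u≤w : u ≤ w) where

        y : ℕ
        y = w + p

        1≤y : 1 ≤ y
        1≤y = ≤-trans 1≤w (m≤m+n w p)

        y≤2cu : y ≤ 2 * c * u
        y≤2cu = begin
          w + p              ≤⟨ +-monoʳ-≤ w (≤-trans p≤p̄ w≥p̄) ⟩
          w + w              ≡⟨ cong (w +_) (+-identityʳ w) ⟨
          2 * w              ≤⟨ *-monoʳ-≤ 2 (w≤cu {u} close) ⟩
          2 * (c * u)        ≡⟨ *-assoc 2 c u ⟨
          2 * c * u          ∎
          where open ≤-Reasoning

        u>C₂ : C₂ < u
        u>C₂ = *-cancelˡ-< c C₂ u (<-≤-trans w>cC₂ (w≤cu {u} close))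

        1≤u : 1 ≤ u
        1≤u = ≤-trans (s≤s z≤n) u>C₂

        -- The ratio j/k is eliminated between the two pairs: k (u y)ᵈ is near j (w y)ᵈ, which is
        -- near k (u′ w)ᵈ. The total error is at most 2 C yᵈ yⁿ; dividing by (u y)ⁿ⁺¹ leaves a
        -- constant, since y ≤ 2 c u.
        cross≤C₂ : ∣ u * y - u′ * w ∣ ≤ C₂
        cross≤C₂ = *-cancelʳ-≤ _ _ (u ^ suc n) {{>-nonZero (1≤^ (suc n) 1≤u)}} (begin
          ∣ u * y - u′ * w ∣ * u ^ suc n    ≤⟨ *-cancelʳ-≤ _ _ (y ^ suc n) {{>-nonZero (1≤^ (suc n) 1≤y)}} scaled ⟩
          2 * C * y ^ suc n                 ≤⟨ *-monoʳ-≤ (2 * C) (^-monoˡ-≤ (suc n) y≤2cu) ⟩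
          2 * C * (2 * c * u) ^ suc n       ≡⟨ cong (2 * C *_) (^-distribʳ-* (2 * c) u (suc n)) ⟩
          2 * C * ((2 * c) ^ suc n * u ^ suc n) ≡⟨ *-assoc (2 * C) _ _ ⟨
          C₂ * u ^ suc n                    ∎)
          where
          open ≤-Reasoning
          e₁ : ∀ k U Y → k * (U * Y) ≡ Y * (k * U)
          e₁ = ℕ-solve-∀
          e₂ : ∀ j W Y → Y * (j * W) ≡ W * (j * Y)
          e₂ = ℕ-solve-∀
          e₃ : ∀ C y z w → y * (y * z) * (C * w) + y * (y * z) * (C * z) ≡ C * (y * (y * z)) * (w + z)
          e₃ = ℕ-solve-∀
          e₄ : ∀ C y z → C * (y * (y * z)) * (z + z) ≡ 2 * C * (y * z) * (y * z)
          e₄ = ℕ-solve-∀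
          scaled : ∣ u * y - u′ * w ∣ * u ^ suc n * y ^ suc n ≤ 2 * C * y ^ suc n * y ^ suc n
          scaled = begin
            ∣ u * y - u′ * w ∣ * u ^ suc n * y ^ suc n
              ≡⟨ trans (*-assoc ∣ u * y - u′ * w ∣ _ _) (cong (∣ u * y - u′ * w ∣ *_) (sym (^-distribʳ-* u y (suc n)))) ⟩
            ∣ u * y - u′ * w ∣ * (u * y) ^ suc n
              ≤⟨ ∣m-n∣*m^p≤∣m^[1+p]-n^[1+p]∣ (u * y) (u′ * w) (suc n) ⟩
            ∣ (u * y) ^ d - (u′ * w) ^ d ∣
              ≤⟨ m≤n*m _ k {{>-nonZero 1≤k}} ⟩
            k * ∣ (u * y) ^ d - (u′ * w) ^ d ∣
              ≡⟨ *-distribˡ-∣-∣ k _ _ ⟩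
            ∣ k * (u * y) ^ d - k * (u′ * w) ^ d ∣
              ≡⟨ cong₂ ∣_-_∣ (trans (cong (k *_) (^-distribʳ-* u y d)) (e₁ k (u ^ d) (y ^ d)))
                             (trans (cong (k *_) (^-distribʳ-* u′ w d)) (e₁ k (u′ ^ d) (w ^ d))) ⟩
            ∣ y ^ d * (k * u ^ d) - w ^ d * (k * u′ ^ d) ∣
              ≤⟨ ∣-∣-triangle (y ^ d * (k * u ^ d)) (y ^ d * (j * w ^ d)) (w ^ d * (k * u′ ^ d)) ⟩
            ∣ y ^ d * (k * u ^ d) - y ^ d * (j * w ^ d) ∣ + ∣ y ^ d * (j * w ^ d) - w ^ d * (k * u′ ^ d) ∣
              ≡⟨ cong (λ t → ∣ y ^ d * (k * u ^ d) - y ^ d * (j * w ^ d) ∣ + t)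
                   (trans (cong (∣_- w ^ d * (k * u′ ^ d) ∣) (e₂ j (w ^ d) (y ^ d))) (∣-∣-comm (w ^ d * (j * y ^ d)) _)) ⟩
            ∣ y ^ d * (k * u ^ d) - y ^ d * (j * w ^ d) ∣ + ∣ w ^ d * (k * u′ ^ d) - w ^ d * (j * y ^ d) ∣
              ≡⟨ cong₂ _+_ (*-distribˡ-∣-∣ (y ^ d) _ _) (*-distribˡ-∣-∣ (w ^ d) _ _) ⟨
            y ^ d * ∣ k * u ^ d - j * w ^ d ∣ + w ^ d * ∣ k * u′ ^ d - j * y ^ d ∣
              ≤⟨ +-mono-≤ (*-monoʳ-≤ (y ^ d) close) (*-mono-≤ (^-monoˡ-≤ d (m≤m+n w p)) close′) ⟩
            y ^ d * (C * w ^ n) + y ^ d * (C * y ^ n)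
              ≡⟨ e₃ C y (y ^ n) (w ^ n) ⟩
            C * y ^ d * (w ^ n + y ^ n)
              ≤⟨ *-monoʳ-≤ (C * y ^ d) (+-monoˡ-≤ (y ^ n) (^-monoˡ-≤ n (m≤m+n w p))) ⟩
            C * y ^ d * (y ^ n + y ^ n)
              ≡⟨ e₄ C y (y ^ n) ⟩
            2 * C * y ^ suc n * y ^ suc n ∎

        -- Otherwise the determinant u y - u′ w would be at least u p ≥ u > `C₂`. This makes q = u′
        -- - u a natural number.
        u≤u′ : u ≤ u′
        u≤u′ = ≮⇒≥ λ u′<u → <⇒≱ u>C₂ (begin
          u                        ≤⟨ m≤m*n u p {{>-nonZero 1≤p}} ⟩
          u * p                    ≡⟨ m+n∸m≡n (u * w) (u * p) ⟨
          u * w + u * p ∸ u * w    ≡⟨ cong (_∸ u * w) (*-distribˡ-+ u w p) ⟨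
          u * y ∸ u * w            ≤⟨ ∸-monoʳ-≤ (u * y) (*-monoˡ-≤ w (<⇒≤ u′<u)) ⟩
          u * y ∸ u′ * w           ≤⟨ m∸n≤∣m-n∣ (u * y) (u′ * w) ⟩
          ∣ u * y - u′ * w ∣       ≤⟨ cross≤C₂ ⟩
          C₂                       ∎)
          where open ≤-Reasoning

        module _ {q} (u′≡u+q : u′ ≡ u + q) where

          δ : ℕ
          δ = ∣ p * u - q * w ∣

          δ≤C₂ : δ ≤ C₂
          δ≤C₂ = subst (_≤ C₂) eq cross≤C₂
            where
            open ≡-Reasoning
            eq : ∣ u * y - u′ * w ∣ ≡ δ
            eq = begin
              ∣ u * y - u′ * w ∣                 ≡⟨ cong (λ t → ∣ u * y - t * w ∣) u′≡u+q ⟩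
              ∣ u * (w + p) - (u + q) * w ∣      ≡⟨ cong₂ ∣_-_∣ (*-distribˡ-+ u w p) (*-distribʳ-+ w u q) ⟩
              ∣ u * w + u * p - u * w + q * w ∣  ≡⟨ ∣m+n-m+o∣≡∣n-o∣ (u * w) (u * p) (q * w) ⟩
              ∣ u * p - q * w ∣                  ≡⟨ cong (∣_- q * w ∣) (*-comm u p) ⟩
              δ                                  ∎

          pu≤M : p * u ≤ (p̄ + C₂) * w
          pu≤M = *-mono-≤ (≤-trans p≤p̄ (m≤m+n p̄ C₂)) u≤w

          qw≤M : q * w ≤ (p̄ + C₂) * w
          qw≤M = begin
            q * w            ≤⟨ m≤n+∣n-m∣ (q * w) (p * u) ⟩
            p * u + δ        ≤⟨ +-mono-≤ (*-mono-≤ p≤p̄ u≤w) (≤-trans δ≤C₂ (m≤m*n C₂ w {{>-nonZero 1≤w}})) ⟩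
            p̄ * w + C₂ * w   ≡⟨ *-distribʳ-+ w p̄ C₂ ⟨
            (p̄ + C₂) * w     ∎
            where open ≤-Reasoning

          -- Multiplied by wᵈ, the difference of the two sides is k ((q w)ᵈ - (p u)ᵈ) + pᵈ (k uᵈ - j
          -- wᵈ). The first term is O(wᵈ⁻¹) because `δ` is bounded, the second even O(wᵈ⁻²). So the
          -- difference is at most `C₃` / w < 1.
          kq^d≡jp^d : k * q ^ d ≡ j * p ^ d
          kq^d≡jp^d = ∣m-n∣≡0⇒m≡n (n<1⇒n≡0 (*-cancelʳ-< w _ 1 (begin-strict
            ∣ k * q ^ d - j * p ^ d ∣ * w
              ≤⟨ *-cancelʳ-≤ _ _ (w ^ suc n) {{>-nonZero (1≤^ (suc n) 1≤w)}} scaled ⟩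
            C₃          <⟨ w>C₃ ⟩
            w           ≡⟨ *-identityˡ w ⟨
            1 * w       ∎)))
            where
            open ≤-Reasoning
            e₁ : ∀ k q w → k * q * w ≡ k * (q * w)
            e₁ = ℕ-solve-∀
            e₂ : ∀ k p u → k * (p * u) ≡ p * (k * u)
            e₂ = ℕ-solve-∀
            e₃ : ∀ j p w → p * (j * w) ≡ j * p * w
            e₃ = ℕ-solve-∀
            M = (p̄ + C₂) * w
            e₄ : ∀ K C₂ d m w z P C → K * (C₂ * (d * (m * (w * z)))) + P * (C * (w * z)) ≡ (K * (C₂ * (d * m)) + P * C) * (w * z)
            e₄ = ℕ-solve-∀
            scaled : ∣ k * q ^ d - j * p ^ d ∣ * w * w ^ suc n ≤ C₃ * w ^ suc n
            scaled = begin
              ∣ k * q ^ d - j * p ^ d ∣ * w * w ^ suc n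
                ≡⟨ *-assoc ∣ k * q ^ d - j * p ^ d ∣ w (w ^ suc n) ⟩
              ∣ k * q ^ d - j * p ^ d ∣ * w ^ d
                ≡⟨ *-distribʳ-∣-∣ (w ^ d) (k * q ^ d) (j * p ^ d) ⟩
              ∣ k * q ^ d * w ^ d - j * p ^ d * w ^ d ∣
                ≤⟨ ∣-∣-triangle (k * q ^ d * w ^ d) (k * (p * u) ^ d) (j * p ^ d * w ^ d) ⟩
              ∣ k * q ^ d * w ^ d - k * (p * u) ^ d ∣ + ∣ k * (p * u) ^ d - j * p ^ d * w ^ d ∣
                ≡⟨ cong₂ _+_
                     (cong (∣_- k * (p * u) ^ d ∣) (trans (e₁ k (q ^ d) (w ^ d)) (cong (k *_) (sym (^-distribʳ-* q w d)))))
                     (cong₂ ∣_-_∣ (trans (cong (k *_) (^-distribʳ-* p u d)) (e₂ k (p ^ d) (u ^ d))) (sym (e₃ j (p ^ d) (w ^ d)))) ⟩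
              ∣ k * (q * w) ^ d - k * (p * u) ^ d ∣ + ∣ p ^ d * (k * u ^ d) - p ^ d * (j * w ^ d) ∣
                ≡⟨ cong₂ _+_ (*-distribˡ-∣-∣ k _ _) (*-distribˡ-∣-∣ (p ^ d) _ _) ⟨
              k * ∣ (q * w) ^ d - (p * u) ^ d ∣ + p ^ d * ∣ k * u ^ d - j * w ^ d ∣
                ≤⟨ +-mono-≤ (*-mono-≤ k≤K (∣m^[1+p]-n^[1+p]∣≤ (suc n) qw≤M pu≤M)) (*-mono-≤ (^-monoˡ-≤ d p≤p̄) close) ⟩
              K * (∣ q * w - p * u ∣ * (d * M ^ suc n)) + p̄ ^ d * (C * w ^ n)
                ≤⟨ +-mono-≤ (*-monoʳ-≤ K (*-monoˡ-≤ (d * M ^ suc n) (≤-trans (≤-reflexive (∣-∣-comm (q * w) (p * u))) δ≤C₂)))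
                            (*-monoʳ-≤ (p̄ ^ d) (*-monoʳ-≤ C (m≤n*m (w ^ n) w {{>-nonZero 1≤w}}))) ⟩
              K * (C₂ * (d * M ^ suc n)) + p̄ ^ d * (C * w ^ suc n)
                ≡⟨ cong (λ t → K * (C₂ * (d * t)) + p̄ ^ d * (C * w ^ suc n)) (^-distribʳ-* (p̄ + C₂) w (suc n)) ⟩
              K * (C₂ * (d * ((p̄ + C₂) ^ suc n * w ^ suc n))) + p̄ ^ d * (C * w ^ suc n)
                ≡⟨ e₄ K C₂ d ((p̄ + C₂) ^ suc n) w (w ^ n) (p̄ ^ d) C ⟩
              C₃ * w ^ suc n ∎

          -- With k qᵈ = j pᵈ exact, k (p u)ᵈ - k (q w)ᵈ equals pᵈ (k uᵈ - j wᵈ), which is O(wᵈ⁻²).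
          -- Dividing by uᵈ⁻¹, of the order of wᵈ⁻¹, gives `δ` w ≤ `C₄` < w.
          pu≡qw : p * u ≡ q * w
          pu≡qw = ∣m-n∣≡0⇒m≡n (n<1⇒n≡0 (*-cancelʳ-< w _ 1 (begin-strict
            δ * w       ≤⟨ *-cancelʳ-≤ _ _ (w ^ n) {{>-nonZero (1≤^ n 1≤w)}} scaled ⟩
            C₄          <⟨ w>C₄ ⟩
            w           ≡⟨ *-identityˡ w ⟨
            1 * w       ∎)))
            where
            open ≤-Reasoning
            e₂ : ∀ k p u → k * (p * u) ≡ p * (k * u)
            e₂ = ℕ-solve-∀
            e₃ : ∀ k j p q w → k * q ≡ j * p → k * (q * w) ≡ p * (j * w)
            e₃ k j p q w eq = trans (sym (*-assoc k q w)) (trans (cong (_* w) eq) (trans (cong (_* w) (*-comm j p)) (*-assoc p j w)))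
            δu : δ * u ^ suc n ≤ p̄ ^ d * (C * w ^ n)
            δu = begin
              δ * u ^ suc n                        ≤⟨ *-monoʳ-≤ δ (^-monoˡ-≤ (suc n) (m≤n*m u p {{>-nonZero 1≤p}})) ⟩
              δ * (p * u) ^ suc n                  ≤⟨ ∣m-n∣*m^p≤∣m^[1+p]-n^[1+p]∣ (p * u) (q * w) (suc n) ⟩
              ∣ (p * u) ^ d - (q * w) ^ d ∣        ≤⟨ m≤n*m _ k {{>-nonZero 1≤k}} ⟩
              k * ∣ (p * u) ^ d - (q * w) ^ d ∣    ≡⟨ *-distribˡ-∣-∣ k _ _ ⟩
              ∣ k * (p * u) ^ d - k * (q * w) ^ d ∣
                ≡⟨ cong₂ ∣_-_∣ (trans (cong (k *_) (^-distribʳ-* p u d)) (e₂ k (p ^ d) (u ^ d)))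
                               (trans (cong (k *_) (^-distribʳ-* q w d)) (e₃ k j (p ^ d) (q ^ d) (w ^ d) kq^d≡jp^d)) ⟩
              ∣ p ^ d * (k * u ^ d) - p ^ d * (j * w ^ d) ∣  ≡⟨ *-distribˡ-∣-∣ (p ^ d) _ _ ⟨
              p ^ d * ∣ k * u ^ d - j * w ^ d ∣    ≤⟨ *-mono-≤ (^-monoˡ-≤ d p≤p̄) close ⟩
              p̄ ^ d * (C * w ^ n)                  ∎
            e₄ : ∀ a b c → a * (b * c) ≡ b * (a * c)
            e₄ = ℕ-solve-∀
            scaled : δ * w * w ^ n ≤ C₄ * w ^ n
            scaled = begin
              δ * w * w ^ n                        ≡⟨ *-assoc δ w (w ^ n) ⟩
              δ * w ^ suc n                        ≤⟨ *-monoʳ-≤ δ (^-monoˡ-≤ (suc n) (w≤cu {u} close)) ⟩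
              δ * (c * u) ^ suc n                  ≡⟨ trans (cong (δ *_) (^-distribʳ-* c u (suc n))) (e₄ δ (c ^ suc n) (u ^ suc n)) ⟩
              c ^ suc n * (δ * u ^ suc n)          ≤⟨ *-monoʳ-≤ (c ^ suc n) δu ⟩
              c ^ suc n * (p̄ ^ d * (C * w ^ n))    ≡⟨ trans (cong (c ^ suc n *_) (sym (*-assoc (p̄ ^ d) C _))) (sym (*-assoc (c ^ suc n) _ _)) ⟩
              C₄ * w ^ n                           ∎

        proportional : ∃[ q ] u′ ≡ u + q × k * q ^ d ≡ j * p ^ d × p * u ≡ q * w
        proportional = let q , u+q≡u′ = m≤n⇒∃[o]m+o≡n u≤u′ in
          q , sym u+q≡u′ , kq^d≡jp^d (sym u+q≡u′) , pu≡qw (sym u+q≡u′)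

open PowerEstimates

-- Counting cells, sparse columns and rows with square divisors

module Counting where

  open import Data.Nat
  open import Data.Nat.Properties
  open import Data.Nat.Divisibility using (_∣_; _∣?_; ∣m+n∣m⇒∣n; n∣m*n; ∣⇒≤)

  Σ< : ℕ → (ℕ → ℕ) → ℕ
  Σ< N g = sum (map g (upTo N))

  Σ<-suc : ∀ N g → Σ< (suc N) g ≡ Σ< N g + g N
  Σ<-suc N g = begin
    sum (map g (upTo (suc N)))       ≡⟨ cong (λ is → sum (map g is)) (upTo-∷ʳ N) ⟨
    sum (map g (upTo N ∷ʳ N))        ≡⟨ cong sum (map-++ g (upTo N) (N ∷ [])) ⟩
    sum (map g (upTo N) ∷ʳ g N)      ≡⟨ sum-++ (map g (upTo N)) (g N ∷ []) ⟩
    Σ< N g + (g N + 0)               ≡⟨ cong (Σ< N g +_) (+-identityʳ (g N)) ⟩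
    Σ< N g + g N                     ∎
    where open ≡-Reasoning

  Σ<-mono : ∀ N {g h} → (∀ i → i < N → g i ≤ h i) → Σ< N g ≤ Σ< N h
  Σ<-mono zero            _   = z≤n
  Σ<-mono (suc N) {g} {h} g≤h rewrite Σ<-suc N g | Σ<-suc N h =
    +-mono-≤ (Σ<-mono N (λ i i<N → g≤h i (m<n⇒m<1+n i<N))) (g≤h N ≤-refl)

  Σ<-+ : ∀ N g h → Σ< N (λ i → g i + h i) ≡ Σ< N g + Σ< N h
  Σ<-+ zero    g h = refl
  Σ<-+ (suc N) g h rewrite Σ<-suc N (λ i → g i + h i) | Σ<-suc N g | Σ<-suc N h | Σ<-+ N g h =
    interchange (Σ< N g) (Σ< N h) (g N) (h N)
    where
    interchange : ∀ a b c d → a + b + (c + d) ≡ a + c + (b + d)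
    interchange = ℕ-solve-∀

  Σ<-const : ∀ N c → Σ< N (λ _ → c) ≡ N * c
  Σ<-const zero    c = refl
  Σ<-const (suc N) c rewrite Σ<-suc N (λ _ → c) | Σ<-const N c = +-comm (N * c) c

  Σ<-≤const : ∀ N {g c} → (∀ i → i < N → g i ≤ c) → Σ< N g ≤ N * c
  Σ<-≤const N {g} {c} g≤c = subst (Σ< N g ≤_) (Σ<-const N c) (Σ<-mono N g≤c)

  *-distribˡ-Σ< : ∀ c N g → c * Σ< N g ≡ Σ< N (λ i → c * g i)
  *-distribˡ-Σ< c zero    g = *-zeroʳ c
  *-distribˡ-Σ< c (suc N) g rewrite Σ<-suc N g | Σ<-suc N (λ i → c * g i) | *-distribˡ-+ c (Σ< N g) (g N) =
    cong (_+ c * g N) (*-distribˡ-Σ< c N g)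

  Σ<-swap : ∀ M N (g : ℕ → ℕ → ℕ) → Σ< M (λ i → Σ< N (λ j → g i j)) ≡ Σ< N (λ j → Σ< M (λ i → g i j))
  Σ<-swap zero    N g = sym (trans (Σ<-const N 0) (*-zeroʳ N))
  Σ<-swap (suc M) N g = begin
    Σ< (suc M) (λ i → Σ< N (g i))                          ≡⟨ Σ<-suc M (λ i → Σ< N (g i)) ⟩
    Σ< M (λ i → Σ< N (g i)) + Σ< N (g M)                   ≡⟨ cong (_+ Σ< N (g M)) (Σ<-swap M N g) ⟩
    Σ< N (λ j → Σ< M (λ i → g i j)) + Σ< N (g M)           ≡⟨ Σ<-+ N (λ j → Σ< M (λ i → g i j)) (g M) ⟨
    Σ< N (λ j → Σ< M (λ i → g i j) + g M j)                ≡⟨ cong sum (map-cong-upTo N) ⟩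
    Σ< N (λ j → Σ< (suc M) (λ i → g i j))                  ∎
    where
    open ≡-Reasoning
    map-cong-upTo : ∀ N → map (λ j → Σ< M (λ i → g i j) + g M j) (upTo N) ≡ map (λ j → Σ< (suc M) (λ i → g i j)) (upTo N)
    map-cong-upTo N = map-cong (λ j → sym (Σ<-suc M (λ i → g i j))) (upTo N)

  term≤Σ< : ∀ {i N} g → i < N → g i ≤ Σ< N g
  term≤Σ< {i} {suc N} g (s≤s i≤N) rewrite Σ<-suc N g with m≤n⇒m<n∨m≡n i≤N
  ... | inj₁ i<N  = ≤-trans (term≤Σ< g i<N) (m≤m+n _ (g N))
  ... | inj₂ refl = m≤n+m (g i) (Σ< i g)

  𝟙 : ∀ {A : Set} → Dec A → ℕ
  𝟙 (yes _) = 1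
  𝟙 (no  _) = 0

  𝟙≥1 : ∀ {A : Set} {d : Dec A} → A → 1 ≤ 𝟙 d
  𝟙≥1 {d = yes _} _ = ≤-refl
  𝟙≥1 {d = no ¬a} a = ⊥-elim (¬a a)

  𝟙≤1 : ∀ {A : Set} (d : Dec A) → 𝟙 d ≤ 1
  𝟙≤1 (yes _) = ≤-refl
  𝟙≤1 (no  _) = z≤n

  -- Each element of S reserves `gap` places for itself. The last reservation may run past the
  -- range, whence the additional `gap` on the right.
  count-sparse : ∀ {S : ℕ → Set} (S? : ∀ i → Dec (S i)) gap →
    (∀ i i′ → i < i′ → S i → S i′ → i + gap ≤ i′) → ∀ N → gap * Σ< N (λ i → 𝟙 (S? i)) ≤ N + gap
  count-sparse {S} S? gap sparse N = let _ , bound , next≤ , _ = invariant N in ≤-trans bound next≤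
    where
    -- next is a lower bound for the elements of S beyond the range counted so far
    invariant : ∀ N → ∃[ next ] gap * Σ< N (λ i → 𝟙 (S? i)) ≤ next × next ≤ N + gap × (∀ i → N ≤ i → S i → next ≤ i)
    invariant zero = 0 , ≤-reflexive (*-zeroʳ gap) , z≤n , λ _ _ _ → z≤n
    invariant (suc N) rewrite Σ<-suc N (λ i → 𝟙 (S? i)) with next , bound , next≤ , first ← invariant N | S? N
    ... | no ¬s = next , subst (λ t → gap * t ≤ next) (sym (+-identityʳ _)) bound , m≤n⇒m≤1+n next≤ ,
        λ i N<i → first i (<⇒≤ N<i)
    ... | yes s = N + gap , (begin
        gap * (Σ< N (λ i → 𝟙 (S? i)) + 1)  ≡⟨ *-distribˡ-+ gap _ 1 ⟩
        gap * Σ< N (λ i → 𝟙 (S? i)) + gap * 1  ≤⟨ +-mono-≤ (≤-trans bound (first N ≤-refl s)) (≤-reflexive (*-identityʳ gap)) ⟩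
        N + gap                            ∎) , n≤1+n _ , λ i N<i s′ → sparse N i N<i s s′
      where open ≤-Reasoning

  -- `remainder` maintains N = c s + r without requiring r < s. If s divides N + 1 = c s + (r + 1),
  -- it divides r + 1, so s can be taken out of r + 1 to pay for the new multiple.
  count-multiples : ∀ s N → Σ< N (λ i → 𝟙 (s ∣? suc i)) * s ≤ N
  count-multiples s N = let r , eq = remainder N in subst (Σ< N (λ i → 𝟙 (s ∣? suc i)) * s ≤_) eq (m≤m+n _ r)
    where
    remainder : ∀ N → ∃[ r ] Σ< N (λ i → 𝟙 (s ∣? suc i)) * s + r ≡ N
    remainder zero = 0 , refl
    remainder (suc N) rewrite Σ<-suc N (λ i → 𝟙 (s ∣? suc i)) with r , eq ← remainder N | s ∣? suc N
    ... | no _ = suc r , trans (cong (λ t → t * s + suc r) (+-identityʳ (Σ< N (λ i → 𝟙 (s ∣? suc i))))) (trans (+-suc _ r) (cong suc eq))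
    ... | yes s∣N+1 with r′ , s+r′≡1+r ← m≤n⇒∃[o]m+o≡n (∣⇒≤ (∣m+n∣m⇒∣n {s} (subst (s ∣_) (sym (trans (+-suc _ r) (cong suc eq))) s∣N+1)
                                                               (n∣m*n (Σ< N (λ i → 𝟙 (s ∣? suc i))) {s}))) =
        r′ , (begin
          (c + 1) * s + r′    ≡⟨ regroup c s r′ ⟩
          c * s + (s + r′)    ≡⟨ cong (c * s +_) s+r′≡1+r ⟩
          c * s + suc r       ≡⟨ trans (+-suc _ r) (cong suc eq) ⟩
          suc N               ∎)
      where
      open ≡-Reasoning
      c = Σ< N (λ i → 𝟙 (s ∣? suc i))
      regroup : ∀ c s r → (c + 1) * s + r ≡ c * s + (s + r)
      regroup = ℕ-solve-∀

  -- Σ 1/k² over K < k ≤ K + M is at most 1/K − 1/(K + M) = M/(K (K + M)).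
  inverse-squares : ∀ K N (c : ℕ → ℕ) → (∀ i → c i * ((suc K + i) * (suc K + i)) ≤ N) →
    ∀ M → K * (K + M) * Σ< M c ≤ M * N
  inverse-squares K N c c≤ zero    = ≤-reflexive (*-zeroʳ (K * (K + 0)))
  inverse-squares zero N c c≤ (suc M) = z≤n
  inverse-squares K@(suc _) N c c≤ (suc M) rewrite Σ<-suc M c = *-cancelˡ-≤ (K + M) (begin
    (K + M) * (K * (K + suc M) * (Σ< M c + c M))
      ≡⟨ e₁ K M (Σ< M c) (c M) ⟩
    (K + M + 1) * (K * (K + M) * Σ< M c) + K * ((K + M) * (K + M + 1) * c M)
      ≤⟨ +-mono-≤ (*-monoʳ-≤ (K + M + 1) (inverse-squares K N c c≤ M)) (*-monoʳ-≤ K last≤) ⟩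
    (K + M + 1) * (M * N) + K * N
      ≡⟨ e₂ K M N ⟩
    (K + M) * (suc M * N) ∎)
    where
    open ≤-Reasoning
    e₁ : ∀ K M σ c → (K + M) * (K * (K + (1 + M)) * (σ + c)) ≡ (K + M + 1) * (K * (K + M) * σ) + K * ((K + M) * (K + M + 1) * c)
    e₁ = ℕ-solve-∀
    e₂ : ∀ K M N → (K + M + 1) * (M * N) + K * N ≡ (K + M) * ((1 + M) * N)
    e₂ = ℕ-solve-∀
    e₃ : ∀ K M c → (K + M) * (K + M + 1) * c + (K + M + 1) * c ≡ c * ((1 + K + M) * (1 + K + M))
    e₃ = ℕ-solve-∀
    -- With k = K + M + 1, weakening k² to (k - 1) k produces the telescoping term 1/(k - 1) - 1/k.
    last≤ : (K + M) * (K + M + 1) * c M ≤ N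
    last≤ = ≤-trans (≤-trans (m≤m+n _ ((K + M + 1) * c M)) (≤-reflexive (e₃ K M (c M)))) (c≤ M)

  -- Summing first over the rows and then over the divisors K < k ≤ K + N gives at most N · N/(K (K
  -- + N)), which is at most N/K.
  count-square-multiples : ∀ K N → K * Σ< N (λ j → Σ< N (λ i → 𝟙 ((suc K + i) * (suc K + i) ∣? suc j))) ≤ N
  count-square-multiples K zero      = ≤-reflexive (*-zeroʳ K)
  count-square-multiples K N@(suc _) = *-cancelˡ-≤ N (begin
    N * (K * Σ< N (λ j → Σ< N (λ i → square∣ i j)))
      ≡⟨ cong (λ t → N * (K * t)) (Σ<-swap N N (λ j i → square∣ i j)) ⟩
    N * (K * Σ< N c)          ≤⟨ *-monoˡ-≤ (K * Σ< N c) (m≤n+m N K) ⟩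
    (K + N) * (K * Σ< N c)    ≡⟨ regroup (K + N) K (Σ< N c) ⟩
    K * (K + N) * Σ< N c      ≤⟨ inverse-squares K N c (λ i → count-multiples ((suc K + i) * (suc K + i)) N) N ⟩
    N * N                     ∎)
    where
    open ≤-Reasoning
    square∣ : ℕ → ℕ → ℕ
    square∣ i j = 𝟙 ((suc K + i) * (suc K + i) ∣? suc j)
    c : ℕ → ℕ
    c i = Σ< N (square∣ i)
    regroup : ∀ a b c → a * (b * c) ≡ b * a * c
    regroup = ℕ-solve-∀

  -- The indicator is local to `count`, so it is exposed as a witness v together with the two
  -- properties used later: v ≤ 1 bounds the count from above, and v ≥ 1 off the invisible cells
  -- bounds it from below.
  count-cells : ∀ P dec N → Σ (ℕ → ℕ → ℕ) λ v → count P dec N ≡ Σ< N (λ i → Σ< N (λ j → v i j)) ×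
    (∀ i j → v i j ≤ 1) × (∀ i j → 1 ≤ v i j ⊎ ¬ P (suc i) (suc j))
  count-cells P dec N = _ , refl , at-most-one , visible-counted
    where
    cells : Σ (ℕ → ℕ → ℕ) λ v → count P dec N ≡ Σ< N (λ i → Σ< N (λ j → v i j))
    cells = _ , refl
    at-most-one : ∀ i j → proj₁ cells i j ≤ 1
    at-most-one i j with dec (suc i) (suc j)
    ... | yes _ = ≤-refl
    ... | no  _ = z≤n
    visible-counted : ∀ i j → 1 ≤ proj₁ cells i j ⊎ ¬ P (suc i) (suc j)
    visible-counted i j with dec (suc i) (suc j)
    ... | yes _ = inj₁ ≤-refl
    ... | no ¬p = inj₂ ¬p

  count-below : ∀ A N → Σ< N (λ i → 𝟙 (suc i <? A)) ≤ A
  count-below A zero = z≤n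
  count-below A (suc N) with suc N ≤? A
  ... | yes N<A = ≤-trans (≤-trans (Σ<-≤const (suc N) (λ i _ → 𝟙≤1 (suc i <? A))) (≤-reflexive (*-identityʳ (suc N)))) N<A
  ... | no  N≮A rewrite Σ<-suc N (λ i → 𝟙 (suc i <? A)) with suc N <? A
  ...   | yes 1+N<A = ⊥-elim (N≮A (<⇒≤ 1+N<A))
  ...   | no  _     = ≤-trans (≤-reflexive (+-identityʳ _)) (count-below A N)

  -- Every cell (a , h) outside P with a ≥ A lies in a sparse family S k j of columns, k , j ≤ K, or
  -- has h divisible by k² for some k > K.
  record Exceptions (P : ℕ → ℕ → Set) (K gap : ℕ) : Set₁ where
    field
      A      : ℕ
      S      : ℕ → ℕ → ℕ → Set
      S?     : ∀ k j a → Dec (S k j a)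
      sparse : ∀ {k j} → k ≤ K → ∀ {a a′} → a < a′ → S k j a → S k j a′ → a + gap ≤ a′
      covers : ∀ {a h} → A ≤ a → 1 ≤ h → (∀ {k j} → k ≤ K → j ≤ K → ¬ S k j a) →
               (∀ {k} → K < k → ¬ (k * k ∣ h)) → P a h

  module _ {P : ℕ → ℕ → Set} (dec : ∀ a h → Dec (P a h)) {K gap : ℕ} (ex : Exceptions P K gap) where

    open Exceptions ex

    module _ (N : ℕ) where

      private
        family column row : ℕ → ℕ
        family i = Σ< (suc K) (λ k → Σ< (suc K) (λ j → 𝟙 (S? k j (suc i))))
        row j = Σ< N (λ i → 𝟙 ((suc K + i) * (suc K + i) ∣? suc j))
        column i = 𝟙 (suc i <? A) + family i

      -- An invisible cell does not by itself exhibit an exception. The number of exceptions is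
      -- decidable to be positive, and were it zero, `covers` would make the cell visible.
      covered : ∀ {i j} → j < N → ¬ P (suc i) (suc j) → 1 ≤ column i + row j
      covered {i} {j} j<N ¬P with 1 ≤? column i + row j
      ... | yes 1≤ = 1≤
      ... | no  1≰ = ⊥-elim (¬P (covers A≤a (s≤s z≤n) no-family no-square))
        where
        A≤a : A ≤ suc i
        A≤a = ≮⇒≥ λ a<A → 1≰ (≤-trans (≤-trans (𝟙≥1 {d = suc i <? A} a<A) (m≤m+n _ (family i))) (m≤m+n (column i) (row j)))
        no-family : ∀ {k j} → k ≤ K → j ≤ K → ¬ S k j (suc i)
        no-family {k} {j′} k≤K j≤K s = 1≰ (begin
          1                                               ≤⟨ 𝟙≥1 {d = S? k j′ (suc i)} s ⟩
          𝟙 (S? k j′ (suc i))                             ≤⟨ term≤Σ< (λ j → 𝟙 (S? k j (suc i))) (s≤s j≤K) ⟩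
          Σ< (suc K) (λ j → 𝟙 (S? k j (suc i)))           ≤⟨ term≤Σ< (λ k → Σ< (suc K) (λ j → 𝟙 (S? k j (suc i)))) (s≤s k≤K) ⟩
          family i                                        ≤⟨ m≤n+m (family i) (𝟙 (suc i <? A)) ⟩
          column i                                        ≤⟨ m≤m+n (column i) (row j) ⟩
          column i + row j                                ∎)
          where open ≤-Reasoning
        no-square : ∀ {k} → K < k → ¬ (k * k ∣ suc j)
        no-square {k} K<k k²∣h with i′ , refl ← m≤n⇒∃[o]m+o≡n K<k = 1≰ (begin
          1                                               ≤⟨ 𝟙≥1 {d = k * k ∣? suc j} k²∣h ⟩
          𝟙 (k * k ∣? suc j)                              ≤⟨ term≤Σ< (λ i → 𝟙 ((suc K + i) * (suc K + i) ∣? suc j)) i′<N ⟩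
          row j                                           ≤⟨ m≤n+m (row j) (column i) ⟩
          column i + row j                                ∎)
          where
          open ≤-Reasoning
          -- The sum in `row` is cut off at N terms. No divisor is lost, since k ≤ k² ≤ h ≤ N.
          i′<N : i′ < N
          i′<N = begin-strict
            i′        <⟨ s≤s (m≤n+m i′ K) ⟩
            k         ≤⟨ m≤m*n k k ⟩
            k * k     ≤⟨ ∣⇒≤ k²∣h ⟩
            suc j     ≤⟨ j<N ⟩
            N         ∎

      family-bound : gap * Σ< N family ≤ suc K * (suc K * (N + gap))
      family-bound = begin
        gap * Σ< N family
          ≡⟨ cong (gap *_) (Σ<-swap N (suc K) (λ i k → Σ< (suc K) (λ j → 𝟙 (S? k j (suc i))))) ⟩
        gap * Σ< (suc K) (λ k → Σ< N (λ i → Σ< (suc K) (λ j → 𝟙 (S? k j (suc i)))))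
          ≡⟨ *-distribˡ-Σ< gap (suc K) _ ⟩
        Σ< (suc K) (λ k → gap * Σ< N (λ i → Σ< (suc K) (λ j → 𝟙 (S? k j (suc i)))))
          ≤⟨ Σ<-≤const (suc K) (λ k k<1+K → per-k k (s≤s⁻¹ k<1+K)) ⟩
        suc K * (suc K * (N + gap)) ∎
        where
        open ≤-Reasoning
        per-k : ∀ k → k ≤ K → gap * Σ< N (λ i → Σ< (suc K) (λ j → 𝟙 (S? k j (suc i)))) ≤ suc K * (N + gap)
        per-k k k≤K = begin
          gap * Σ< N (λ i → Σ< (suc K) (λ j → 𝟙 (S? k j (suc i))))
            ≡⟨ cong (gap *_) (Σ<-swap N (suc K) (λ i j → 𝟙 (S? k j (suc i)))) ⟩
          gap * Σ< (suc K) (λ j → Σ< N (λ i → 𝟙 (S? k j (suc i))))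
            ≡⟨ *-distribˡ-Σ< gap (suc K) _ ⟩
          Σ< (suc K) (λ j → gap * Σ< N (λ i → 𝟙 (S? k j (suc i))))
            ≤⟨ Σ<-≤const (suc K) (λ j _ → count-sparse (λ i → S? k j (suc i)) gap
                 (λ i i′ i<i′ s s′ → s≤s⁻¹ (sparse k≤K (s≤s i<i′) s s′)) N) ⟩
          suc K * (N + gap) ∎

      count≤N² : count P dec N ≤ N * N
      count≤N² = let v , count≡ , v≤1 , _ = count-cells P dec N in begin
        count P dec N                   ≡⟨ count≡ ⟩
        Σ< N (λ i → Σ< N (λ j → v i j)) ≤⟨ Σ<-≤const N (λ i _ → Σ<-≤const N (λ j _ → v≤1 i j)) ⟩
        N * (N * 1)                     ≡⟨ cong (N *_) (*-identityʳ N) ⟩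
        N * N                           ∎
        where open ≤-Reasoning

      -- A union bound: an exceptional column or row costs N cells. Overlaps, such as a row with
      -- several square divisors, are counted repeatedly, which an upper bound permits.
      N²≤count+exceptions : N * N ≤ count P dec N + N * (A + Σ< N family + Σ< N row)
      N²≤count+exceptions = let v , count≡ , _ , seen = count-cells P dec N in begin
        N * N
          ≡⟨ trans (Σ<-const N (Σ< N (λ _ → 1))) (cong (N *_) (trans (Σ<-const N 1) (*-identityʳ N))) ⟨
        Σ< N (λ _ → Σ< N (λ _ → 1))
          ≤⟨ Σ<-mono N (λ i _ → Σ<-mono N (λ j j<N → cell (v i j) j<N (seen i j))) ⟩
        Σ< N (λ i → Σ< N (λ j → v i j + (column i + row j)))
          ≤⟨ Σ<-mono N (λ i _ → ≤-reflexive (row-sum (v i) i)) ⟩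
        Σ< N (λ i → Σ< N (v i) + (N * column i + Σ< N row))
          ≡⟨ trans (Σ<-+ N (λ i → Σ< N (v i)) _) (cong (Σ< N (λ i → Σ< N (v i)) +_)
               (trans (Σ<-+ N (λ i → N * column i) _) (cong₂ _+_ (sym (*-distribˡ-Σ< N N column)) (Σ<-const N (Σ< N row))))) ⟩
        Σ< N (λ i → Σ< N (v i)) + (N * Σ< N column + N * Σ< N row)
          ≡⟨ cong₂ _+_ (sym count≡) (sym (*-distribˡ-+ N (Σ< N column) (Σ< N row))) ⟩
        count P dec N + N * (Σ< N column + Σ< N row)
          ≡⟨ cong (λ t → count P dec N + N * (t + Σ< N row)) (Σ<-+ N (λ i → 𝟙 (suc i <? A)) family) ⟩
        count P dec N + N * (Σ< N (λ i → 𝟙 (suc i <? A)) + Σ< N family + Σ< N row)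
          ≤⟨ +-monoʳ-≤ (count P dec N) (*-monoʳ-≤ N (+-monoˡ-≤ (Σ< N row) (+-monoˡ-≤ (Σ< N family) (count-below A N)))) ⟩
        count P dec N + N * (A + Σ< N family + Σ< N row) ∎
        where
        open ≤-Reasoning
        cell : ∀ {i j} v → j < N → 1 ≤ v ⊎ ¬ P (suc i) (suc j) → 1 ≤ v + (column i + row j)
        cell {i} {j} v _   (inj₁ 1≤v) = ≤-trans 1≤v (m≤m+n v _)
        cell {i} {j} v j<N (inj₂ ¬P)  = ≤-trans (covered j<N ¬P) (m≤n+m _ v)
        row-sum : ∀ w i → Σ< N (λ j → w j + (column i + row j)) ≡ Σ< N w + (N * column i + Σ< N row)
        row-sum w i = trans (Σ<-+ N w _) (cong (Σ< N w +_) (trans (Σ<-+ N (λ _ → column i) row) (cong (_+ Σ< N row) (Σ<-const N (column i)))))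

      -- After multiplication by 4 q, the choice of K leaves at most N for the rows, and the choice
      -- of `gap` absorbs the number (K + 1)² of families and leaves at most N + `gap` for them. The
      -- columns below A and the extra `gap` cost less than N together, so the total is below 3 N,
      -- hence below 4 N.
      missing-bound : ∀ q → K ≡ 4 * q → gap ≡ 4 * q * (suc K * suc K) → 4 * q * A + gap < N →
        (N * N ∸ count P dec N) * q < N * N
      missing-bound q K≡ gap≡ N-large = *-cancelˡ-< 4 _ _ (begin-strict
        4 * (miss * q)
          ≡⟨ e₁ miss q ⟩
        4 * q * miss
          ≤⟨ *-monoʳ-≤ (4 * q) (m≤n+o⇒m∸n≤o (N * N) (count P dec N) N²≤count+exceptions) ⟩
        4 * q * (N * (A + Σ< N family + Σ< N row))
          ≡⟨ e₂ (4 * q) N A (Σ< N family) (Σ< N row) ⟩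
        N * (4 * q * A + 4 * q * Σ< N family + 4 * q * Σ< N row)
          ≤⟨ *-monoʳ-≤ N (+-mono-≤ (+-monoʳ-≤ (4 * q * A) families) squares) ⟩
        N * (4 * q * A + (N + gap) + N)
          ≡⟨ cong (N *_) (e₃ (4 * q * A) N gap) ⟩
        N * (4 * q * A + gap + 2 * N)
          <⟨ *-monoʳ-< N {{>-nonZero (≤-trans (s≤s z≤n) N-large)}} (+-monoˡ-< (2 * N) N-large) ⟩
        N * (N + 2 * N)
          ≤⟨ ≤-trans (m≤m+n _ (N * N)) (≤-reflexive (e₄ N)) ⟩
        4 * (N * N) ∎)
        where
        open ≤-Reasoning
        miss = N * N ∸ count P dec N
        e₁ : ∀ m q → 4 * (m * q) ≡ 4 * q * m
        e₁ = ℕ-solve-∀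
        e₂ : ∀ Q N A f r → Q * (N * (A + f + r)) ≡ N * (Q * A + Q * f + Q * r)
        e₂ = ℕ-solve-∀
        e₃ : ∀ a N g → a + (N + g) + N ≡ a + g + 2 * N
        e₃ = ℕ-solve-∀
        e₄ : ∀ N → N * (N + 2 * N) + N * N ≡ 4 * (N * N)
        e₄ = ℕ-solve-∀
        e₅ : ∀ B Q f → B * B * (Q * f) ≡ Q * (B * B) * f
        e₅ = ℕ-solve-∀
        squares : 4 * q * Σ< N row ≤ N
        squares = subst (λ t → t * Σ< N row ≤ N) K≡ (count-square-multiples K N)
        families : 4 * q * Σ< N family ≤ N + gap
        families = *-cancelˡ-≤ (suc K * suc K) (begin
          suc K * suc K * (4 * q * Σ< N family)   ≡⟨ e₅ (suc K) (4 * q) (Σ< N family) ⟩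
          4 * q * (suc K * suc K) * Σ< N family   ≡⟨ cong (_* Σ< N family) gap≡ ⟨
          gap * Σ< N family                       ≤⟨ family-bound ⟩
          suc K * (suc K * (N + gap))             ≡⟨ *-assoc (suc K) (suc K) (N + gap) ⟨
          suc K * suc K * (N + gap)               ∎)

open Counting

open import Data.Integer as ℤ using (ℤ; +_; -[1+_]; ∣_∣; _⊖_; +≤+; _^_)
open import Data.Nat.Divisibility using (_∣_; divides; ∣-trans)

-- The embedding of the integers in the rationals

ι : ℤ → ℚ
ι z = z ℚ./ 1

toℚᵘ-ι : ∀ z → toℚᵘ (ι z) ℚᵘ.≃ mkℚᵘ z 0
toℚᵘ-ι z = ℚₚ.toℚᵘ-fromℚᵘ (mkℚᵘ z 0)

ι-injective : ∀ {x y} → ι x ≡ ι y → x ≡ y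
ι-injective {x} {y} eq with *≡* x1≡y1 ← ℚₚ.fromℚᵘ-injective {mkℚᵘ x 0} {mkℚᵘ y 0} eq =
  trans (sym (ℤₚ.*-identityʳ x)) (trans x1≡y1 (ℤₚ.*-identityʳ y))

ι-+ : ∀ x y → ι (x ℤ.+ y) ≡ ι x ℚ.+ ι y
ι-+ x y = ℚₚ.toℚᵘ-injective (begin
  toℚᵘ (ι (x ℤ.+ y))            ≈⟨ toℚᵘ-ι (x ℤ.+ y) ⟩
  mkℚᵘ (x ℤ.+ y) 0              ≈⟨ *≡* (identity x y) ⟩
  mkℚᵘ x 0 ℚᵘ.+ mkℚᵘ y 0        ≈⟨ ℚᵘₚ.+-cong (toℚᵘ-ι x) (toℚᵘ-ι y) ⟨
  toℚᵘ (ι x) ℚᵘ.+ toℚᵘ (ι y)    ≈⟨ ℚₚ.toℚᵘ-homo-+ (ι x) (ι y) ⟨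
  toℚᵘ (ι x ℚ.+ ι y)            ∎)
  where
  open import Relation.Binary.Reasoning.Setoid ℚᵘₚ.≃-setoid
  identity : ∀ x y → (x ℤ.+ y) ℤ.* + 1 ≡ (x ℤ.* + 1 ℤ.+ y ℤ.* + 1) ℤ.* + 1
  identity = ℤ-solve-∀

ι-* : ∀ x y → ι (x ℤ.* y) ≡ ι x ℚ.* ι y
ι-* x y = ℚₚ.toℚᵘ-injective (begin
  toℚᵘ (ι (x ℤ.* y))            ≈⟨ toℚᵘ-ι (x ℤ.* y) ⟩
  mkℚᵘ x 0 ℚᵘ.* mkℚᵘ y 0        ≈⟨ ℚᵘₚ.*-cong (toℚᵘ-ι x) (toℚᵘ-ι y) ⟨
  toℚᵘ (ι x) ℚᵘ.* toℚᵘ (ι y)    ≈⟨ ℚₚ.toℚᵘ-homo-* (ι x) (ι y) ⟨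
  toℚᵘ (ι x ℚ.* ι y)            ∎)
  where open import Relation.Binary.Reasoning.Setoid ℚᵘₚ.≃-setoid

ι-neg : ∀ x → ι (ℤ.- x) ≡ ℚ.- ι x
ι-neg x = ℚₚ.toℚᵘ-injective (begin
  toℚᵘ (ι (ℤ.- x))    ≈⟨ toℚᵘ-ι (ℤ.- x) ⟩
  ℚᵘ.- mkℚᵘ x 0       ≈⟨ ℚᵘₚ.-‿cong (toℚᵘ-ι x) ⟨
  ℚᵘ.- toℚᵘ (ι x)     ≈⟨ ℚₚ.toℚᵘ-homo‿- (ι x) ⟨
  toℚᵘ (ℚ.- ι x)      ∎)
  where open import Relation.Binary.Reasoning.Setoid ℚᵘₚ.≃-setoid

ι-- : ∀ x y → ι (x ℤ.- y) ≡ ι x ℚ.- ι y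
ι-- x y = trans (ι-+ x (ℤ.- y)) (cong (ι x ℚ.+_) (ι-neg y))

ι-^ : ∀ x n → ι (x ℤ.^ n) ≡ ι x ^ℚ n
ι-^ x zero    = refl
ι-^ x (suc n) = trans (ι-* x (x ℤ.^ n)) (cong (ι x ℚ.*_) (ι-^ x n))

ι-evalℤ : ∀ f x → ι (evalℤ f x) ≡ evalℚ f (ι x)
ι-evalℤ []       x = refl
ι-evalℤ (c ∷ cs) x = trans (ι-+ c (x ℤ.* evalℤ cs x))
  (cong (ι c ℚ.+_) (trans (ι-* x (evalℤ cs x)) (cong (ι x ℚ.*_) (ι-evalℤ cs x))))

/-*-cancel : ∀ z p .{{_ : NonZero p}} → (z ℚ./ p) ℚ.* ι (+ p) ≡ ι z
/-*-cancel z p@(suc p-1) = ℚₚ.toℚᵘ-injective (begin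
  toℚᵘ ((z ℚ./ p) ℚ.* ι (+ p))           ≈⟨ ℚₚ.toℚᵘ-homo-* (z ℚ./ p) (ι (+ p)) ⟩
  toℚᵘ (z ℚ./ p) ℚᵘ.* toℚᵘ (ι (+ p))     ≈⟨ ℚᵘₚ.*-cong (ℚₚ.toℚᵘ-fromℚᵘ (mkℚᵘ z p-1)) (toℚᵘ-ι (+ p)) ⟩
  mkℚᵘ z p-1 ℚᵘ.* mkℚᵘ (+ p) 0
    ≈⟨ *≡* (trans (ℤₚ.*-assoc z (+ p) (+ 1)) (cong (z ℤ.*_) (trans (ℤₚ.*-identityʳ (+ p)) (cong +_ (sym (ℕₚ.*-identityʳ p)))))) ⟩
  mkℚᵘ z 0                               ≈⟨ toℚᵘ-ι z ⟨
  toℚᵘ (ι z)                             ∎)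
  where open import Relation.Binary.Reasoning.Setoid ℚᵘₚ.≃-setoid

-- Rewriting f in the variable X = D x + b and completing the d-th power

-- The coefficients of carry + (X − b) e(X) + tail X^(length e).
mulLinear : ℤ → ℤ → ℤ → Poly → Poly
mulLinear b carry tail []       = (carry ℤ.+ tail) ∷ []
mulLinear b carry tail (y ∷ ys) = (carry ℤ.- b ℤ.* y) ∷ mulLinear b y tail ys

length-mulLinear : ∀ b carry tail e → length (mulLinear b carry tail e) ≡ suc (length e)
length-mulLinear b carry tail []       = refl
length-mulLinear b carry tail (y ∷ ys) = cong suc (length-mulLinear b y tail ys)

evalℚ-mulLinear : ∀ b carry tail e X → evalℚ (mulLinear b carry tail e) X ≡
  ι carry ℚ.+ (X ℚ.- ι b) ℚ.* evalℚ e X ℚ.+ ι tail ℚ.* X ^ℚ length e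
evalℚ-mulLinear b carry tail []       X = trans
  (cong (ℚ._+ X ℚ.* 0ℚ) (ι-+ carry tail))
  (solve 4 (λ c t x b → c :+ t :+ x :* con 0ℚ := c :+ (x :- b) :* con 0ℚ :+ t :* con 1ℚ) refl (ι carry) (ι tail) X (ι b))
  where open +-*-Solver
evalℚ-mulLinear b carry tail (y ∷ ys) X = trans
  (cong₂ (λ s t → s ℚ.+ X ℚ.* t) (trans (ι-- carry (b ℤ.* y)) (cong (λ t → ι carry ℚ.- t) (ι-* b y))) (evalℚ-mulLinear b y tail ys X))
  (solve 7 (λ c b y x e t p → c :- b :* y :+ x :* (y :+ (x :- b) :* e :+ t :* p) := c :+ (x :- b) :* (y :+ x :* e) :+ t :* (x :* p)) refl
     (ι carry) (ι b) (ι y) X (evalℚ ys X) (ι tail) (X ^ℚ length ys))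
  where open +-*-Solver

nextToLast : Poly → ℤ
nextToLast []           = + 0
nextToLast (s ∷ [])     = + 0
nextToLast (s ∷ l ∷ []) = s
nextToLast (c ∷ f@(_ ∷ _ ∷ _)) = nextToLast f

module _ (D b : ℤ) where

  private
    X : ℚ → ℚ
    X x = ι D ℚ.* x ℚ.+ ι b

  -- Horner recursion. Passing from f to c + x f multiplies the expansion by D x = X - b and adds
  -- the constant D^(n+2) c. The leading coefficient l persists, the next one decreases by b l, and
  -- its own product with -b falls on Xⁿ, one place beyond the list e; this is the `tail` of
  -- `mulLinear`.
  change-variable : ∀ n f {l} → length f ≡ 2 ℕ.+ n → last f ≡ just l →
    ∃[ e ] length e ≡ n × (∀ x → (ι D ^ℚ suc n) ℚ.* evalℚ f x ≡
      ι l ℚ.* X x ^ℚ suc n ℚ.+ ι (nextToLast f ℤ.* D ℤ.- + suc n ℤ.* (l ℤ.* b)) ℚ.* X x ^ℚ n ℚ.+ evalℚ e (X x))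
  change-variable zero    (s ∷ l ∷ []) refl refl = [] , refl , λ x → trans
    (solve 5 (λ D s l b x → D :* con 1ℚ :* (s :+ x :* (l :+ x :* con 0ℚ)) :=
                l :* ((D :* x :+ b) :* con 1ℚ) :+ (s :* D :- l :* b) :* con 1ℚ :+ con 0ℚ) refl (ι D) (ι s) (ι l) (ι b) x)
    (cong (λ t → ι l ℚ.* (X x ℚ.* 1ℚ) ℚ.+ t ℚ.* 1ℚ ℚ.+ 0ℚ) (sym ι-t))
    where
    open +-*-Solver
    ι-t : ι (s ℤ.* D ℤ.- + 1 ℤ.* (l ℤ.* b)) ≡ ι s ℚ.* ι D ℚ.- ι l ℚ.* ι b
    ι-t = trans (ι-- (s ℤ.* D) (+ 1 ℤ.* (l ℤ.* b)))
      (cong₂ ℚ._-_ (ι-* s D) (trans (cong ι (ℤₚ.*-identityˡ (l ℤ.* b))) (ι-* l b)))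
  change-variable (suc n) (c ∷ f@(s ∷ l₁ ∷ f′)) {l} len top with e , refl , eq ← change-variable n f (ℕₚ.suc-injective len) top =
    mulLinear b (D ℤ.^ (2 ℕ.+ n) ℤ.* c) (ℤ.- (b ℤ.* t)) e , length-mulLinear b _ _ e , step
    where
    t = nextToLast f ℤ.* D ℤ.- + suc n ℤ.* (l ℤ.* b)
    t′ = nextToLast f ℤ.* D ℤ.- + suc (suc n) ℤ.* (l ℤ.* b)
    t-step : ∀ s D N l b → s ℤ.* D ℤ.- (+ 1 ℤ.+ N) ℤ.* (l ℤ.* b) ≡ s ℤ.* D ℤ.- N ℤ.* (l ℤ.* b) ℤ.- b ℤ.* l
    t-step = ℤ-solve-∀
    ι-t′ : ι t′ ≡ ι t ℚ.- ι b ℚ.* ι l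
    ι-t′ = trans (cong ι (t-step (nextToLast f) D (+ suc n) l b)) (trans (ι-- t (b ℤ.* l)) (cong (λ r → ι t ℚ.- r) (ι-* b l)))
    ι-carry : ι (D ℤ.^ (2 ℕ.+ n) ℤ.* c) ≡ (ι D ^ℚ (2 ℕ.+ n)) ℚ.* ι c
    ι-carry = trans (ι-* (D ℤ.^ (2 ℕ.+ n)) c) (cong (ℚ._* ι c) (ι-^ D (2 ℕ.+ n)))
    ι-tail : ι (ℤ.- (b ℤ.* t)) ≡ ℚ.- (ι b ℚ.* ι t)
    ι-tail = trans (ι-neg (b ℤ.* t)) (cong ℚ.-_ (ι-* b t))
    step : ∀ x → (ι D ^ℚ suc (suc n)) ℚ.* evalℚ (c ∷ f) x ≡
      ι l ℚ.* X x ^ℚ suc (suc n) ℚ.+ ι t′ ℚ.* X x ^ℚ suc n ℚ.+ evalℚ (mulLinear b (D ℤ.^ (2 ℕ.+ n) ℤ.* c) (ℤ.- (b ℤ.* t)) e) (X x)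
    step x = begin
      (ι D ^ℚ suc (suc n)) ℚ.* evalℚ (c ∷ f) x
        ≡⟨ solve 5 (λ D P c x F → D :* P :* (c :+ x :* F) := D :* P :* c :+ D :* x :* (P :* F)) refl
             (ι D) (ι D ^ℚ suc n) (ι c) x (evalℚ f x) ⟩
      (ι D ^ℚ suc (suc n)) ℚ.* ι c ℚ.+ ι D ℚ.* x ℚ.* ((ι D ^ℚ suc n) ℚ.* evalℚ f x)
        ≡⟨ cong (λ r → (ι D ^ℚ suc (suc n)) ℚ.* ι c ℚ.+ ι D ℚ.* x ℚ.* r) (eq x) ⟩
      (ι D ^ℚ suc (suc n)) ℚ.* ι c ℚ.+ ι D ℚ.* x ℚ.* (ι l ℚ.* X x ^ℚ suc n ℚ.+ ι t ℚ.* X x ^ℚ n ℚ.+ evalℚ e (X x))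
        ≡⟨ solve 8 (λ C D x b l t q e → let X = D :* x :+ b in
             C :+ D :* x :* (l :* (X :* q) :+ t :* q :+ e) :=
             l :* (X :* (X :* q)) :+ (t :- b :* l) :* (X :* q) :+ (C :+ (X :- b) :* e :+ (:- (b :* t)) :* q)) refl
             ((ι D ^ℚ suc (suc n)) ℚ.* ι c) (ι D) x (ι b) (ι l) (ι t) (X x ^ℚ n) (evalℚ e (X x)) ⟩
      ι l ℚ.* X x ^ℚ suc (suc n) ℚ.+ (ι t ℚ.- ι b ℚ.* ι l) ℚ.* X x ^ℚ suc n ℚ.+
        ((ι D ^ℚ suc (suc n)) ℚ.* ι c ℚ.+ (X x ℚ.- ι b) ℚ.* evalℚ e (X x) ℚ.+ ℚ.- (ι b ℚ.* ι t) ℚ.* X x ^ℚ n)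
        ≡⟨ cong₂ (λ r r′ → ι l ℚ.* X x ^ℚ suc (suc n) ℚ.+ r ℚ.* X x ^ℚ suc n ℚ.+ r′) (sym ι-t′)
             (sym (trans (evalℚ-mulLinear b _ _ e (X x))
               (cong₂ (λ r r′ → r ℚ.+ (X x ℚ.- ι b) ℚ.* evalℚ e (X x) ℚ.+ r′ ℚ.* X x ^ℚ n) ι-carry ι-tail))) ⟩
      ι l ℚ.* X x ^ℚ suc (suc n) ℚ.+ ι t′ ℚ.* X x ^ℚ suc n ℚ.+ evalℚ (mulLinear b (D ℤ.^ (2 ℕ.+ n) ℤ.* c) (ℤ.- (b ℤ.* t)) e) (X x) ∎
      where
      open ≡-Reasoning
      open +-*-Solver

^ℚ-distribʳ-* : ∀ x y n → (x ℚ.* y) ^ℚ n ≡ (x ^ℚ n) ℚ.* (y ^ℚ n)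
^ℚ-distribʳ-* x y zero    = refl
^ℚ-distribʳ-* x y (suc n) = trans (cong (x ℚ.* y ℚ.*_) (^ℚ-distribʳ-* x y n))
  (solve 4 (λ a b c d → a :* b :* (c :* d) := a :* c :* (b :* d)) refl x y (x ^ℚ n) (y ^ℚ n))
  where open +-*-Solver

1ℚ^ℚ : ∀ n → 1ℚ ^ℚ n ≡ 1ℚ
1ℚ^ℚ zero    = refl
1ℚ^ℚ (suc n) = trans (ℚₚ.*-identityˡ (1ℚ ^ℚ n)) (1ℚ^ℚ n)

evalℚ-zeros : ∀ {e} x → All (_≡ + 0) e → evalℚ e x ≡ 0ℚ
evalℚ-zeros x []           = refl
evalℚ-zeros x (refl ∷ zs) = trans (ℚₚ.+-identityˡ _) (trans (cong (x ℚ.*_) (evalℚ-zeros x zs)) (ℚₚ.*-zeroʳ x))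

pos-^ : ∀ x n → + (x ℕ.^ n) ≡ (+ x) ℤ.^ n
pos-^ x zero    = refl
pos-^ x (suc n) = trans (ℤₚ.pos-* x (x ℕ.^ n)) (cong (+ x ℤ.*_) (pos-^ x n))

∣i^n∣≡∣i∣^n : ∀ i n → ∣ i ℤ.^ n ∣ ≡ ∣ i ∣ ℕ.^ n
∣i^n∣≡∣i∣^n i zero    = refl
∣i^n∣≡∣i∣^n i (suc n) = trans (ℤₚ.∣i*j∣≡∣i∣*∣j∣ i (i ℤ.^ n)) (cong (∣ i ∣ ℕ.*_) (∣i^n∣≡∣i∣^n i n))

-- `l` and `D` are the predecessors of the leading coefficient and of the scaling factor, so that
-- both are positive by construction.
module DepressedForm (f : Poly) (n l D : ℕ) (D≡d*l : suc D ≡ (2 ℕ.+ n) ℕ.* suc l) (e : Poly) where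

  private
    d : ℕ
    d = 2 ℕ.+ n
    b : ℤ
    b = nextToLast f
    i : ℚ
    i = + 1 ℚ./ suc D
    X : ℚ → ℚ
    X x = ι (+ suc D) ℚ.* x ℚ.+ ι b

  module _ (eq : ∀ x → (ι (+ suc D) ^ℚ d) ℚ.* evalℚ f x ≡
      ι (+ suc l) ℚ.* X x ^ℚ d ℚ.+ ι (b ℤ.* + suc D ℤ.- + d ℤ.* (+ suc l ℤ.* b)) ℚ.* X x ^ℚ suc n ℚ.+ evalℚ e (X x)) where

    coeff≡0 : b ℤ.* + suc D ℤ.- + d ℤ.* (+ suc l ℤ.* b) ≡ + 0
    coeff≡0 = trans (cong (λ t → b ℤ.* t ℤ.- + d ℤ.* (+ suc l ℤ.* b)) (trans (cong +_ D≡d*l) (ℤₚ.pos-* d (suc l)))) (cancels b (+ d) (+ suc l))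
      where
      cancels : ∀ b d l → b ℤ.* (d ℤ.* l) ℤ.- d ℤ.* (l ℤ.* b) ≡ + 0
      cancels = ℤ-solve-∀

    over-ℚ : ∀ x → (ι (+ suc D) ^ℚ d) ℚ.* evalℚ f x ≡ ι (+ suc l) ℚ.* X x ^ℚ d ℚ.+ evalℚ e (X x)
    over-ℚ x = trans (eq x) (trans (cong (λ t → ι (+ suc l) ℚ.* X x ^ℚ d ℚ.+ ι t ℚ.* X x ^ℚ suc n ℚ.+ evalℚ e (X x)) coeff≡0)
      (solve 3 (λ a q r → a :+ con 0ℚ :* q :+ r := a :+ r) refl (ι (+ suc l) ℚ.* X x ^ℚ d) (X x ^ℚ suc n) (evalℚ e (X x))))
      where open +-*-Solver

    over-ℤ : ∀ x → + (suc D ℕ.^ d) ℤ.* evalℤ f x ≡ + suc l ℤ.* (+ suc D ℤ.* x ℤ.+ b) ℤ.^ d ℤ.+ evalℤ e (+ suc D ℤ.* x ℤ.+ b)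
    over-ℤ x = ι-injective (begin
      ι (+ (suc D ℕ.^ d) ℤ.* evalℤ f x)
        ≡⟨ ι-* (+ (suc D ℕ.^ d)) (evalℤ f x) ⟩
      ι (+ (suc D ℕ.^ d)) ℚ.* ι (evalℤ f x)
        ≡⟨ cong₂ ℚ._*_ (trans (cong ι (pos-^ (suc D) d)) (ι-^ (+ suc D) d)) (ι-evalℤ f x) ⟩
      (ι (+ suc D) ^ℚ d) ℚ.* evalℚ f (ι x)
        ≡⟨ over-ℚ (ι x) ⟩
      ι (+ suc l) ℚ.* X (ι x) ^ℚ d ℚ.+ evalℚ e (X (ι x))
        ≡⟨ cong (λ t → ι (+ suc l) ℚ.* t ^ℚ d ℚ.+ evalℚ e t) ι-X ⟨
      ι (+ suc l) ℚ.* ι Z ^ℚ d ℚ.+ evalℚ e (ι Z)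
        ≡⟨ cong₂ ℚ._+_ (trans (ι-* (+ suc l) (Z ℤ.^ d)) (cong (ι (+ suc l) ℚ.*_) (ι-^ Z d))) (ι-evalℤ e Z) ⟨
      ι (+ suc l ℤ.* Z ℤ.^ d) ℚ.+ ι (evalℤ e Z)
        ≡⟨ ι-+ (+ suc l ℤ.* Z ℤ.^ d) (evalℤ e Z) ⟨
      ι (+ suc l ℤ.* Z ℤ.^ d ℤ.+ evalℤ e Z) ∎)
      where
      open ≡-Reasoning
      Z = + suc D ℤ.* x ℤ.+ b
      ι-X : ι Z ≡ X (ι x)
      ι-X = trans (ι-+ (+ suc D ℤ.* x) b) (cong (ℚ._+ ι b) (ι-* (+ suc D) x))

    iD≡1 : i ℚ.* ι (+ suc D) ≡ 1ℚ
    iD≡1 = /-*-cancel (+ 1) (suc D)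

    -- Here X = D (x - r) with r = - b / D, and `i` = 1 / D. Its contrapositive is how the
    -- assumption of two distinct roots enters, as a nonzero coefficient of e.
    single-root : All (_≡ + 0) e → ∀ x → evalℚ f x ≡ ι (+ suc l) ℚ.* ((x ℚ.- (ℚ.- ι b ℚ.* i)) ^ℚ d)
    single-root zeros x = begin
      evalℚ f x
        ≡⟨ ℚₚ.*-identityˡ (evalℚ f x) ⟨
      1ℚ ℚ.* evalℚ f x
        ≡⟨ cong (ℚ._* evalℚ f x) (trans (cong (_^ℚ d) iD≡1) (1ℚ^ℚ d)) ⟨
      ((i ℚ.* ι (+ suc D)) ^ℚ d) ℚ.* evalℚ f x
        ≡⟨ cong (ℚ._* evalℚ f x) (^ℚ-distribʳ-* i (ι (+ suc D)) d) ⟩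
      (i ^ℚ d) ℚ.* (ι (+ suc D) ^ℚ d) ℚ.* evalℚ f x
        ≡⟨ ℚₚ.*-assoc (i ^ℚ d) (ι (+ suc D) ^ℚ d) (evalℚ f x) ⟩
      (i ^ℚ d) ℚ.* ((ι (+ suc D) ^ℚ d) ℚ.* evalℚ f x)
        ≡⟨ cong ((i ^ℚ d) ℚ.*_) (trans (over-ℚ x) (trans (cong (ι (+ suc l) ℚ.* X x ^ℚ d ℚ.+_) (evalℚ-zeros (X x) zeros)) (ℚₚ.+-identityʳ _))) ⟩
      (i ^ℚ d) ℚ.* (ι (+ suc l) ℚ.* X x ^ℚ d)
        ≡⟨ solve 3 (λ a b c → a :* (b :* c) := b :* (a :* c)) refl (i ^ℚ d) (ι (+ suc l)) (X x ^ℚ d) ⟩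
      ι (+ suc l) ℚ.* ((i ^ℚ d) ℚ.* X x ^ℚ d)
        ≡⟨ cong (ι (+ suc l) ℚ.*_) (^ℚ-distribʳ-* i (X x) d) ⟨
      ι (+ suc l) ℚ.* ((i ℚ.* X x) ^ℚ d)
        ≡⟨ cong (λ t → ι (+ suc l) ℚ.* (t ^ℚ d)) iX ⟩
      ι (+ suc l) ℚ.* ((x ℚ.- (ℚ.- ι b ℚ.* i)) ^ℚ d) ∎
      where
      open ≡-Reasoning
      open +-*-Solver
      iX : i ℚ.* X x ≡ x ℚ.- (ℚ.- ι b ℚ.* i)
      iX = trans (solve 4 (λ i D x b → i :* (D :* x :+ b) := i :* D :* x :+ b :* i) refl i (ι (+ suc D)) x (ι b))
        (trans (cong (λ t → t ℚ.* x ℚ.+ ι b ℚ.* i) iD≡1)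
          (solve 3 (λ x b i → con 1ℚ :* x :+ b :* i := x :- (:- b :* i)) refl x (ι b) i))

-- Completing the d-th power: with D = d·lc and b the next-to-leading coefficient, the coefficient of
-- X^(d−1) vanishes, and f has a single root exactly when the remainder e vanishes as well.
depressed-form : ∀ f n l D → suc D ≡ (2 ℕ.+ n) ℕ.* suc l → length f ≡ 3 ℕ.+ n → last f ≡ just (+ suc l) →
  ¬ HasSingleRoot f (2 ℕ.+ n) (+ suc l) →
  ∃[ b ] ∃[ e ] length e ≡ suc n × ¬ All (_≡ + 0) e ×
    (∀ x → + (suc D ℕ.^ (2 ℕ.+ n)) ℤ.* evalℤ f x ≡
           + suc l ℤ.* (+ suc D ℤ.* x ℤ.+ b) ℤ.^ (2 ℕ.+ n) ℤ.+ evalℤ e (+ suc D ℤ.* x ℤ.+ b))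
depressed-form f n l D D≡d*l len top multiroot =
  let e , len-e , eq = change-variable (+ suc D) (nextToLast f) (suc n) f len top in
  nextToLast f , e , len-e ,
  (λ zeros → multiroot (ℚ.- ι (nextToLast f) ℚ.* (+ 1 ℚ./ suc D) , DepressedForm.single-root f n l D D≡d*l e eq zeros)) ,
  DepressedForm.over-ℤ f n l D D≡d*l e eq

-- Integer polynomials: size, homotheties and signs

heightSum : Poly → ℕ
heightSum []       = 0
heightSum (c ∷ cs) = ∣ c ∣ ℕ.+ heightSum cs

∣evalℤ∣≤ : ∀ e n {x Y} → length e ℕ.≤ suc n → ∣ x ∣ ℕ.≤ Y → 1 ℕ.≤ Y → ∣ evalℤ e x ∣ ℕ.≤ heightSum e ℕ.* Y ℕ.^ n
∣evalℤ∣≤ []       n             _         _   _   = z≤n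
∣evalℤ∣≤ (c ∷ []) n {x} {Y}     _         _   1≤Y = begin
  ∣ c ℤ.+ x ℤ.* + 0 ∣       ≡⟨ cong (λ t → ∣ c ℤ.+ t ∣) (ℤₚ.*-zeroʳ x) ⟩
  ∣ c ℤ.+ + 0 ∣             ≤⟨ ℤₚ.∣i+j∣≤∣i∣+∣j∣ c (+ 0) ⟩
  ∣ c ∣ ℕ.+ 0               ≤⟨ ℕₚ.m≤m*n _ (Y ℕ.^ n) {{ℕ.>-nonZero (1≤^ n 1≤Y)}} ⟩
  (∣ c ∣ ℕ.+ 0) ℕ.* Y ℕ.^ n ∎
  where open ℕₚ.≤-Reasoning
∣evalℤ∣≤ (c ∷ e@(_ ∷ _)) (suc n) {x} {Y} (s≤s le) x≤Y 1≤Y = begin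
  ∣ c ℤ.+ x ℤ.* evalℤ e x ∣             ≤⟨ ℤₚ.∣i+j∣≤∣i∣+∣j∣ c (x ℤ.* evalℤ e x) ⟩
  ∣ c ∣ ℕ.+ ∣ x ℤ.* evalℤ e x ∣         ≡⟨ cong (∣ c ∣ ℕ.+_) (ℤₚ.∣i*j∣≡∣i∣*∣j∣ x (evalℤ e x)) ⟩
  ∣ c ∣ ℕ.+ ∣ x ∣ ℕ.* ∣ evalℤ e x ∣     ≤⟨ ℕₚ.+-mono-≤ (ℕₚ.m≤m*n ∣ c ∣ (Y ℕ.^ suc n) {{ℕ.>-nonZero (1≤^ (suc n) 1≤Y)}})
                                             (ℕₚ.*-mono-≤ x≤Y (∣evalℤ∣≤ e n {x} le x≤Y 1≤Y)) ⟩
  ∣ c ∣ ℕ.* Y ℕ.^ suc n ℕ.+ Y ℕ.* (heightSum e ℕ.* Y ℕ.^ n)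
    ≡⟨ cong (∣ c ∣ ℕ.* Y ℕ.^ suc n ℕ.+_) (swap Y (heightSum e) (Y ℕ.^ n)) ⟩
  ∣ c ∣ ℕ.* Y ℕ.^ suc n ℕ.+ heightSum e ℕ.* Y ℕ.^ suc n  ≡⟨ ℕₚ.*-distribʳ-+ (Y ℕ.^ suc n) ∣ c ∣ (heightSum e) ⟨
  heightSum (c ∷ e) ℕ.* Y ℕ.^ suc n     ∎
  where
  open ℕₚ.≤-Reasoning
  swap : ∀ a b c → a ℕ.* (b ℕ.* c) ≡ b ℕ.* (a ℕ.* c)
  swap a b c = trans (sym (ℕₚ.*-assoc a b c)) (trans (cong (ℕ._* c) (ℕₚ.*-comm a b)) (ℕₚ.*-assoc b a c))

-- On the line p u = q w, an identity pʳ e(u) = qʳ e(w) with r > deg e forces w to divide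
-- c (pⁱ − qⁱ), where c is the lowest nonzero coefficient of e and i ≤ r.
homothety-bound : ∀ e r {p q u w} → length e ℕ.< r → 1 ℕ.≤ q → q ℕ.< p → 1 ℕ.≤ w → p ℕ.* u ≡ q ℕ.* w →
  + (p ℕ.^ r) ℤ.* evalℤ e (+ u) ≡ + (q ℕ.^ r) ℤ.* evalℤ e (+ w) →
  All (_≡ + 0) e ⊎ w ℕ.≤ heightSum e ℕ.* p ℕ.^ r
homothety-bound []       r                       _        _   _   _   _     _  = inj₁ []
homothety-bound (c ∷ e) (suc r) {p} {q} {u} {w} (s≤s e<r) 1≤q q<p 1≤w pu≡qw eq with c ℤ.≟ + 0
-- With zero constant term both sides contain the factor p u = q w. Cancelling it lowers r together
-- with the degree.
... | yes refl = Sum.map (refl ∷_) widen (homothety-bound e r e<r 1≤q q<p 1≤w pu≡qw reduced)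
  where
  instance
    q≢0 : NonZero q
    q≢0 = ℕ.>-nonZero 1≤q
    w≢0 : NonZero w
    w≢0 = ℕ.>-nonZero 1≤w
    p≢0 : NonZero p
    p≢0 = ℕ.>-nonZero (ℕₚ.≤-trans 1≤q (ℕₚ.<⇒≤ q<p))
  widen : w ℕ.≤ heightSum e ℕ.* p ℕ.^ r → w ℕ.≤ heightSum e ℕ.* p ℕ.^ suc r
  widen le = ℕₚ.≤-trans le (ℕₚ.*-monoʳ-≤ (heightSum e) (ℕₚ.m≤n*m (p ℕ.^ r) p))
  lhs : ∀ A p u E → A ℤ.* E ℤ.* (p ℤ.* u) ≡ p ℤ.* A ℤ.* (+ 0 ℤ.+ u ℤ.* E)
  lhs = ℤ-solve-∀
  rhs : ∀ B q w F → q ℤ.* B ℤ.* (+ 0 ℤ.+ w ℤ.* F) ≡ B ℤ.* F ℤ.* (q ℤ.* w)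
  rhs = ℤ-solve-∀
  reduced : + (p ℕ.^ r) ℤ.* evalℤ e (+ u) ≡ + (q ℕ.^ r) ℤ.* evalℤ e (+ w)
  reduced = ℤₚ.*-cancelʳ-≡ _ _ (+ (q ℕ.* w)) {{ℕₚ.m*n≢0 q w}} (begin
    + (p ℕ.^ r) ℤ.* evalℤ e (+ u) ℤ.* + (q ℕ.* w)          ≡⟨ cong (λ t → + (p ℕ.^ r) ℤ.* evalℤ e (+ u) ℤ.* + t) pu≡qw ⟨
    + (p ℕ.^ r) ℤ.* evalℤ e (+ u) ℤ.* + (p ℕ.* u)          ≡⟨ cong (+ (p ℕ.^ r) ℤ.* evalℤ e (+ u) ℤ.*_) (ℤₚ.pos-* p u) ⟩
    + (p ℕ.^ r) ℤ.* evalℤ e (+ u) ℤ.* (+ p ℤ.* + u)        ≡⟨ lhs (+ (p ℕ.^ r)) (+ p) (+ u) (evalℤ e (+ u)) ⟩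
    + p ℤ.* + (p ℕ.^ r) ℤ.* (+ 0 ℤ.+ + u ℤ.* evalℤ e (+ u)) ≡⟨ cong (ℤ._* (+ 0 ℤ.+ + u ℤ.* evalℤ e (+ u))) (ℤₚ.pos-* p (p ℕ.^ r)) ⟨
    + (p ℕ.^ suc r) ℤ.* (+ 0 ℤ.+ + u ℤ.* evalℤ e (+ u))    ≡⟨ eq ⟩
    + (q ℕ.^ suc r) ℤ.* (+ 0 ℤ.+ + w ℤ.* evalℤ e (+ w))    ≡⟨ cong (ℤ._* (+ 0 ℤ.+ + w ℤ.* evalℤ e (+ w))) (ℤₚ.pos-* q (q ℕ.^ r)) ⟩
    + q ℤ.* + (q ℕ.^ r) ℤ.* (+ 0 ℤ.+ + w ℤ.* evalℤ e (+ w)) ≡⟨ rhs (+ (q ℕ.^ r)) (+ q) (+ w) (evalℤ e (+ w)) ⟩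
    + (q ℕ.^ r) ℤ.* evalℤ e (+ w) ℤ.* (+ q ℤ.* + w)        ≡⟨ cong (+ (q ℕ.^ r) ℤ.* evalℤ e (+ w) ℤ.*_) (ℤₚ.pos-* q w) ⟨
    + (q ℕ.^ r) ℤ.* evalℤ e (+ w) ℤ.* + (q ℕ.* w)          ∎)
    where open ≡-Reasoning
-- Besides the term in w on the right, p^(r+1) u E = p^r q w E is a multiple of w. What remains is c
-- times s = p^(r+1) - q^(r+1), nonzero because q < p.
... | no c≢0 with s , Q+s≡P ← ℕₚ.m≤n⇒∃[o]m+o≡n (ℕₚ.<⇒≤ (ℕₚ.^-monoˡ-< (suc r) q<p)) = inj₂ bounded
  where
  E F A B z : ℤ
  E = evalℤ e (+ u)
  F = evalℤ e (+ w)
  A = + (p ℕ.^ r)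
  B = + (q ℕ.^ suc r)
  z = B ℤ.* F ℤ.- A ℤ.* + q ℤ.* E
  B+s≡Ap : B ℤ.+ + s ≡ A ℤ.* + p
  B+s≡Ap = trans (sym (ℤₚ.pos-+ (q ℕ.^ suc r) s)) (trans (cong +_ Q+s≡P) (trans (ℤₚ.pos-* p (p ℕ.^ r)) (ℤₚ.*-comm (+ p) A)))
  e₁ : ∀ c s B u E → c ℤ.* s ≡ (B ℤ.+ s) ℤ.* (c ℤ.+ u ℤ.* E) ℤ.- B ℤ.* c ℤ.- (B ℤ.+ s) ℤ.* (u ℤ.* E)
  e₁ = ℤ-solve-∀
  e₂ : ∀ c B w F A p u E → B ℤ.* (c ℤ.+ w ℤ.* F) ℤ.- B ℤ.* c ℤ.- A ℤ.* p ℤ.* (u ℤ.* E) ≡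
    B ℤ.* w ℤ.* F ℤ.- A ℤ.* (p ℤ.* u) ℤ.* E
  e₂ = ℤ-solve-∀
  e₃ : ∀ B w F A q E → B ℤ.* w ℤ.* F ℤ.- A ℤ.* (q ℤ.* w) ℤ.* E ≡ w ℤ.* (B ℤ.* F ℤ.- A ℤ.* q ℤ.* E)
  e₃ = ℤ-solve-∀
  cs≡wz : c ℤ.* + s ≡ + w ℤ.* z
  cs≡wz = begin
    c ℤ.* + s   ≡⟨ e₁ c (+ s) B (+ u) E ⟩
    (B ℤ.+ + s) ℤ.* (c ℤ.+ + u ℤ.* E) ℤ.- B ℤ.* c ℤ.- (B ℤ.+ + s) ℤ.* (+ u ℤ.* E)
      ≡⟨ cong₂ (λ t t′ → t ℤ.* (c ℤ.+ + u ℤ.* E) ℤ.- B ℤ.* c ℤ.- t′ ℤ.* (+ u ℤ.* E))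
               (trans (sym (ℤₚ.pos-+ (q ℕ.^ suc r) s)) (cong +_ Q+s≡P)) B+s≡Ap ⟩
    + (p ℕ.^ suc r) ℤ.* (c ℤ.+ + u ℤ.* E) ℤ.- B ℤ.* c ℤ.- A ℤ.* + p ℤ.* (+ u ℤ.* E)
      ≡⟨ cong (λ t → t ℤ.- B ℤ.* c ℤ.- A ℤ.* + p ℤ.* (+ u ℤ.* E)) eq ⟩
    B ℤ.* (c ℤ.+ + w ℤ.* F) ℤ.- B ℤ.* c ℤ.- A ℤ.* + p ℤ.* (+ u ℤ.* E)
      ≡⟨ e₂ c B (+ w) F A (+ p) (+ u) E ⟩
    B ℤ.* + w ℤ.* F ℤ.- A ℤ.* (+ p ℤ.* + u) ℤ.* E
      ≡⟨ cong (λ t → B ℤ.* + w ℤ.* F ℤ.- A ℤ.* t ℤ.* E) (trans (sym (ℤₚ.pos-* p u)) (trans (cong +_ pu≡qw) (ℤₚ.pos-* q w))) ⟩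
    B ℤ.* + w ℤ.* F ℤ.- A ℤ.* (+ q ℤ.* + w) ℤ.* E
      ≡⟨ e₃ B (+ w) F A (+ q) E ⟩
    + w ℤ.* z ∎
    where open ≡-Reasoning
  abs-eq : ∣ c ∣ ℕ.* s ≡ w ℕ.* ∣ z ∣
  abs-eq = trans (sym (ℤₚ.∣i*j∣≡∣i∣*∣j∣ c (+ s))) (trans (cong ∣_∣ cs≡wz) (ℤₚ.∣i*j∣≡∣i∣*∣j∣ (+ w) z))
  s≢0 : s ≢ 0
  s≢0 refl = ℕₚ.<⇒≢ (ℕₚ.^-monoˡ-< (suc r) q<p) (trans (sym (ℕₚ.+-identityʳ _)) Q+s≡P)
  wz≢0 : NonZero (w ℕ.* ∣ z ∣)
  wz≢0 = subst NonZero abs-eq (ℕₚ.m*n≢0 ∣ c ∣ s {{ℕ.≢-nonZero (λ c≡0 → c≢0 (ℤₚ.∣i∣≡0⇒i≡0 c≡0))}} {{ℕ.≢-nonZero s≢0}})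
  bounded : w ℕ.≤ heightSum (c ∷ e) ℕ.* p ℕ.^ suc r
  bounded = begin
    w                                 ≤⟨ ℕₚ.m≤m*n w ∣ z ∣ {{ℕₚ.m*n≢0⇒n≢0 w {{wz≢0}}}} ⟩
    w ℕ.* ∣ z ∣                       ≡⟨ abs-eq ⟨
    ∣ c ∣ ℕ.* s                       ≤⟨ ℕₚ.*-mono-≤ (ℕₚ.m≤m+n ∣ c ∣ (heightSum e)) (ℕₚ.≤-trans (ℕₚ.m≤n+m s (q ℕ.^ suc r)) (ℕₚ.≤-reflexive Q+s≡P)) ⟩
    heightSum (c ∷ e) ℕ.* p ℕ.^ suc r ∎
    where open ℕₚ.≤-Reasoning

∣m-n∣≤ : ∀ {m n k} → m ℕ.≤ n ℕ.+ k → n ℕ.≤ m ℕ.+ k → ℕ.∣ m - n ∣ ℕ.≤ k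
∣m-n∣≤ {m} {n} m≤n+k n≤m+k with ℕₚ.∣m-n∣≡[m∸n]∨[n∸m] m n
... | inj₁ eq = ℕₚ.≤-trans (ℕₚ.≤-reflexive eq) (ℕₚ.m≤n+o⇒m∸n≤o m n m≤n+k)
... | inj₂ eq = ℕₚ.≤-trans (ℕₚ.≤-reflexive eq) (ℕₚ.m≤n+o⇒m∸n≤o n m n≤m+k)

∣∣i+j∣-∣i∣∣≤∣j∣ : ∀ i j → ℕ.∣ ∣ i ℤ.+ j ∣ - ∣ i ∣ ∣ ℕ.≤ ∣ j ∣
∣∣i+j∣-∣i∣∣≤∣j∣ i j = ∣m-n∣≤ (ℤₚ.∣i+j∣≤∣i∣+∣j∣ i j) (begin
  ∣ i ∣                        ≡⟨ cong ∣_∣ (cancels i j) ⟩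
  ∣ (i ℤ.+ j) ℤ.- j ∣          ≤⟨ ℤₚ.∣i-j∣≤∣i∣+∣j∣ (i ℤ.+ j) j ⟩
  ∣ i ℤ.+ j ∣ ℕ.+ ∣ j ∣        ∎)
  where
  open ℕₚ.≤-Reasoning
  cancels : ∀ i j → i ≡ (i ℤ.+ j) ℤ.- j
  cancels = ℤ-solve-∀

∣j∣≤m⇒m+j≡∣m+j∣ : ∀ m j → ∣ j ∣ ℕ.≤ m → + m ℤ.+ j ≡ + ∣ + m ℤ.+ j ∣
∣j∣≤m⇒m+j≡∣m+j∣ m (+ j)    _   = refl
∣j∣≤m⇒m+j≡∣m+j∣ m -[1+ j ] j<m = trans eq (cong (λ t → + ∣ t ∣) (sym eq))
  where
  eq : m ⊖ suc j ≡ + (m ℕ.∸ suc j)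
  eq = ℤₚ.⊖-≥ j<m

-- If m + j were negative, its absolute value would be at most ∣ j ∣. Used to recover the sign of
-- `var u` from its size.
∣j∣<∣m+j∣⇒m+j≡∣m+j∣ : ∀ m j → ∣ j ∣ ℕ.< ∣ + m ℤ.+ j ∣ → + m ℤ.+ j ≡ + ∣ + m ℤ.+ j ∣
∣j∣<∣m+j∣⇒m+j≡∣m+j∣ m (+ j)    _  = refl
∣j∣<∣m+j∣⇒m+j≡∣m+j∣ m -[1+ j ] lt with suc j ℕ.≤? m
... | yes j<m = ∣j∣≤m⇒m+j≡∣m+j∣ m -[1+ j ] j<m
... | no  j≮m = ⊥-elim (ℕₚ.<⇒≱ lt (ℕₚ.≤-trans (ℕₚ.≤-reflexive (ℤₚ.∣⊖∣-< (ℕₚ.≰⇒> j≮m))) (ℕₚ.m∸n≤m (suc j) m)))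

-- The factor 2 serves negative j with m < ∣ j ∣: there ∣ m + j ∣ may be as large as ∣ j ∣, and n -
-- ∣ j ∣ has to exceed that.
∣m+j∣<∣n+j∣ : ∀ {m n} j → m ℕ.< n → 2 ℕ.* ∣ j ∣ ℕ.< n → ∣ + m ℤ.+ j ∣ ℕ.< ∣ + n ℤ.+ j ∣
∣m+j∣<∣n+j∣         (+ j)    m<n _  = ℕₚ.+-monoˡ-< j m<n
∣m+j∣<∣n+j∣ {m} {n} -[1+ j ] m<n 2j<n = subst (∣ m ⊖ suc j ∣ ℕ.<_) (cong ∣_∣ (sym (ℤₚ.⊖-≥ j<n))) below
  where
  j<n : suc j ℕ.≤ n
  j<n = ℕₚ.≤-trans (ℕₚ.m≤m+n (suc j) _) (ℕₚ.<⇒≤ 2j<n)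
  below : ∣ m ⊖ suc j ∣ ℕ.< n ℕ.∸ suc j
  below with suc j ℕ.≤? m
  ... | yes j<m = subst (ℕ._< n ℕ.∸ suc j) (cong ∣_∣ (sym (ℤₚ.⊖-≥ j<m))) (ℕₚ.∸-monoˡ-< m<n j<m)
  ... | no  j≮m = ℕₚ.≤-<-trans (ℕₚ.≤-trans (ℕₚ.≤-reflexive (ℤₚ.∣⊖∣-< (ℕₚ.≰⇒> j≮m))) (ℕₚ.m∸n≤m (suc j) m))
      (ℕₚ.m+n≤o⇒m≤o∸n (suc (suc j)) (ℕₚ.≤-trans (ℕₚ.≤-reflexive (cong (suc (suc j) ℕ.+_) (sym (ℕₚ.+-identityʳ (suc j))))) 2j<n))

-- Growth of f and spacing of the solutions of k f(u) = j f(a)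

module Growth (f e : Poly) (n l D : ℕ) (b : ℤ) (1≤l : 1 ℕ.≤ l) (1≤D : 1 ℕ.≤ D)
  (len-e : length e ≡ suc n) (e≢0 : ¬ All (_≡ + 0) e)
  (depressed : ∀ x → + (D ℕ.^ (2 ℕ.+ n)) ℤ.* evalℤ f x ≡
                     + l ℤ.* (+ D ℤ.* x ℤ.+ b) ℤ.^ (2 ℕ.+ n) ℤ.+ evalℤ e (+ D ℤ.* x ℤ.+ b))
  where

  private
    d E : ℕ
    d = 2 ℕ.+ n
    E = heightSum e

    instance
      l≢0 : NonZero l
      l≢0 = ℕ.>-nonZero 1≤l
      D≢0 : NonZero D
      D≢0 = ℕ.>-nonZero 1≤D
      D^d≢0 : NonZero (D ℕ.^ d)
      D^d≢0 = ℕₚ.m^n≢0 D d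

  G : ℤ → ℤ
  G X = + l ℤ.* X ℤ.^ d ℤ.+ evalℤ e X

  var : ℕ → ℤ
  var a = + (D ℕ.* a) ℤ.+ b

  D^d*f≡G : ∀ a → + (D ℕ.^ d) ℤ.* evalℤ f (+ a) ≡ G (var a)
  D^d*f≡G a = trans (depressed (+ a)) (cong G (cong (ℤ._+ b) (sym (ℤₚ.pos-* D a))))

  D^d*∣f∣≡∣G∣ : ∀ a → D ℕ.^ d ℕ.* ∣ evalℤ f (+ a) ∣ ≡ ∣ G (var a) ∣
  D^d*∣f∣≡∣G∣ a = trans (sym (ℤₚ.∣i*j∣≡∣i∣*∣j∣ (+ (D ℕ.^ d)) (evalℤ f (+ a)))) (cong ∣_∣ (D^d*f≡G a))

  ∣lX^d∣ : ∀ X → ∣ + l ℤ.* X ℤ.^ d ∣ ≡ l ℕ.* ∣ X ∣ ℕ.^ d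
  ∣lX^d∣ X = trans (ℤₚ.∣i*j∣≡∣i∣*∣j∣ (+ l) (X ℤ.^ d)) (cong (l ℕ.*_) (∣i^n∣≡∣i∣^n X d))

  ∣e∣≤ : ∀ {X Y} → ∣ X ∣ ℕ.≤ Y → 1 ℕ.≤ Y → ∣ evalℤ e X ∣ ℕ.≤ E ℕ.* Y ℕ.^ n
  ∣e∣≤ {X} = ∣evalℤ∣≤ e n {X} (ℕₚ.≤-reflexive len-e)

  G-close : ∀ {X Y} → ∣ X ∣ ℕ.≤ Y → 1 ℕ.≤ Y → ℕ.∣ ∣ G X ∣ - l ℕ.* ∣ X ∣ ℕ.^ d ∣ ℕ.≤ E ℕ.* Y ℕ.^ n
  G-close {X} {Y} X≤Y 1≤Y = begin
    ℕ.∣ ∣ G X ∣ - l ℕ.* ∣ X ∣ ℕ.^ d ∣         ≡⟨ cong (ℕ.∣ ∣ G X ∣ -_∣) (∣lX^d∣ X) ⟨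
    ℕ.∣ ∣ G X ∣ - ∣ + l ℤ.* X ℤ.^ d ∣ ∣       ≤⟨ ∣∣i+j∣-∣i∣∣≤∣j∣ (+ l ℤ.* X ℤ.^ d) (evalℤ e X) ⟩
    ∣ evalℤ e X ∣                             ≤⟨ ∣e∣≤ {X} X≤Y 1≤Y ⟩
    E ℕ.* Y ℕ.^ n                             ∎
    where open ℕₚ.≤-Reasoning

  G-nonneg : ∀ {W} → E ℕ.< W → G (+ W) ≡ + ∣ G (+ W) ∣
  G-nonneg {W} E<W = subst (λ t → t ℤ.+ evalℤ e (+ W) ≡ + ∣ t ℤ.+ evalℤ e (+ W) ∣) top
    (∣j∣≤m⇒m+j≡∣m+j∣ (l ℕ.* W ℕ.^ d) (evalℤ e (+ W)) (begin
      ∣ evalℤ e (+ W) ∣          ≤⟨ ∣e∣≤ {+ W} ℕₚ.≤-refl 1≤W ⟩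
      E ℕ.* W ℕ.^ n              ≤⟨ ℕₚ.*-monoˡ-≤ (W ℕ.^ n) (ℕₚ.<⇒≤ E<W) ⟩
      W ℕ.^ suc n                ≤⟨ ℕₚ.m≤n*m (W ℕ.^ suc n) W {{ℕ.>-nonZero 1≤W}} ⟩
      W ℕ.^ d                    ≤⟨ ℕₚ.m≤n*m (W ℕ.^ d) l ⟩
      l ℕ.* W ℕ.^ d              ∎))
    where
    open ℕₚ.≤-Reasoning
    1≤W : 1 ℕ.≤ W
    1≤W = ℕₚ.≤-trans (s≤s z≤n) E<W
    top : + (l ℕ.* W ℕ.^ d) ≡ + l ℤ.* (+ W) ℤ.^ d
    top = trans (ℤₚ.pos-* l (W ℕ.^ d)) (cong (+ l ℤ.*_) (pos-^ W d))

  -- As ∣ X ∣ and W differ by at least 1, l Wᵈ exceeds l ∣ X ∣ᵈ by at least l Wᵈ⁻¹. For W > 2 E this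
  -- is more than the two errors E Wᵈ⁻² together.
  ∣G∣-mono : ∀ {X W} → ∣ X ∣ ℕ.< W → 2 ℕ.* E ℕ.< W → ∣ G X ∣ ℕ.< ∣ G (+ W) ∣
  ∣G∣-mono {X} {W} X<W 2E<W = ℕₚ.+-cancelʳ-< (E ℕ.* W ℕ.^ n) _ _ (begin-strict
    ∣ G X ∣ ℕ.+ E ℕ.* W ℕ.^ n
      ≤⟨ ℕₚ.+-monoˡ-≤ _ (ℕₚ.m≤n+∣m-n∣ ∣ G X ∣ (l ℕ.* ∣ X ∣ ℕ.^ d)) ⟩
    l ℕ.* ∣ X ∣ ℕ.^ d ℕ.+ ℕ.∣ ∣ G X ∣ - l ℕ.* ∣ X ∣ ℕ.^ d ∣ ℕ.+ E ℕ.* W ℕ.^ n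
      ≤⟨ ℕₚ.+-monoˡ-≤ _ (ℕₚ.+-monoʳ-≤ (l ℕ.* ∣ X ∣ ℕ.^ d) (G-close {X} (ℕₚ.<⇒≤ X<W) 1≤W)) ⟩
    l ℕ.* ∣ X ∣ ℕ.^ d ℕ.+ E ℕ.* W ℕ.^ n ℕ.+ E ℕ.* W ℕ.^ n
      ≡⟨ regroup (l ℕ.* ∣ X ∣ ℕ.^ d) E (W ℕ.^ n) ⟩
    l ℕ.* ∣ X ∣ ℕ.^ d ℕ.+ 2 ℕ.* E ℕ.* W ℕ.^ n
      <⟨ ℕₚ.+-monoʳ-< (l ℕ.* ∣ X ∣ ℕ.^ d) (ℕₚ.*-monoˡ-< (W ℕ.^ n) {{ℕ.>-nonZero (1≤^ n 1≤W)}} 2E<W) ⟩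
    l ℕ.* ∣ X ∣ ℕ.^ d ℕ.+ W ℕ.^ suc n
      ≤⟨ ℕₚ.+-monoʳ-≤ (l ℕ.* ∣ X ∣ ℕ.^ d) (ℕₚ.m≤n*m (W ℕ.^ suc n) l) ⟩
    l ℕ.* ∣ X ∣ ℕ.^ d ℕ.+ l ℕ.* W ℕ.^ suc n
      ≡⟨ ℕₚ.*-distribˡ-+ l _ _ ⟨
    l ℕ.* (∣ X ∣ ℕ.* ∣ X ∣ ℕ.^ suc n ℕ.+ W ℕ.^ suc n)
      ≤⟨ ℕₚ.*-monoʳ-≤ l (ℕₚ.+-monoˡ-≤ _ (ℕₚ.*-monoʳ-≤ ∣ X ∣ (ℕₚ.^-monoˡ-≤ (suc n) (ℕₚ.<⇒≤ X<W)))) ⟩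
    l ℕ.* (∣ X ∣ ℕ.* W ℕ.^ suc n ℕ.+ W ℕ.^ suc n)
      ≡⟨ cong (l ℕ.*_) (ℕₚ.+-comm _ (W ℕ.^ suc n)) ⟩
    l ℕ.* (suc ∣ X ∣ ℕ.* W ℕ.^ suc n)
      ≤⟨ ℕₚ.*-monoʳ-≤ l (ℕₚ.*-monoˡ-≤ (W ℕ.^ suc n) X<W) ⟩
    l ℕ.* W ℕ.^ d
      ≤⟨ ℕₚ.m≤n+∣n-m∣ _ ∣ G (+ W) ∣ ⟩
    ∣ G (+ W) ∣ ℕ.+ ℕ.∣ ∣ G (+ W) ∣ - l ℕ.* W ℕ.^ d ∣
      ≤⟨ ℕₚ.+-monoʳ-≤ ∣ G (+ W) ∣ (G-close {+ W} ℕₚ.≤-refl 1≤W) ⟩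
    ∣ G (+ W) ∣ ℕ.+ E ℕ.* W ℕ.^ n ∎)
    where
    open ℕₚ.≤-Reasoning
    1≤W : 1 ℕ.≤ W
    1≤W = ℕₚ.≤-trans (s≤s z≤n) 2E<W
    regroup : ∀ a E w → a ℕ.+ E ℕ.* w ℕ.+ E ℕ.* w ≡ a ℕ.+ 2 ℕ.* E ℕ.* w
    regroup = ℕ-solve-∀

  record Large (w a : ℕ) : Set where
    field
      W     : ℕ
      var≡W : var a ≡ + W
      w≤W   : w ℕ.≤ W
      below : ∀ {u} → u ℕ.< a → ∣ var u ∣ ℕ.< W

  large : ∀ w {a} → suc (2 ℕ.* ∣ b ∣ ℕ.+ w) ℕ.≤ a → Large w a
  large w {a} a≥ = record
    { W     = ∣ var a ∣
    ; var≡W = ∣j∣≤m⇒m+j≡∣m+j∣ (D ℕ.* a) b (ℕₚ.≤-trans (ℕₚ.m≤m+n ∣ b ∣ _) (ℕₚ.<⇒≤ 2b<Da))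
    ; w≤W   = ℕₚ.+-cancelʳ-≤ ∣ b ∣ _ _ (begin
        w ℕ.+ ∣ b ∣                 ≤⟨ ℕₚ.≤-trans (ℕₚ.m≤n+m (w ℕ.+ ∣ b ∣) ∣ b ∣) (ℕₚ.≤-reflexive (regroup ∣ b ∣ w)) ⟩
        2 ℕ.* ∣ b ∣ ℕ.+ w           ≤⟨ ℕₚ.<⇒≤ sum<Da ⟩
        D ℕ.* a                     ≡⟨ cong ∣_∣ (cancels (+ (D ℕ.* a)) b) ⟩
        ∣ var a ℤ.- b ∣             ≤⟨ ℤₚ.∣i-j∣≤∣i∣+∣j∣ (var a) b ⟩
        ∣ var a ∣ ℕ.+ ∣ b ∣         ∎)
    ; below = λ u<a → ∣m+j∣<∣n+j∣ b (ℕₚ.*-monoʳ-< D u<a) 2b<Da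
    }
    where
    open ℕₚ.≤-Reasoning
    sum<Da : 2 ℕ.* ∣ b ∣ ℕ.+ w ℕ.< D ℕ.* a
    sum<Da = ℕₚ.≤-trans a≥ (ℕₚ.m≤n*m a D)
    2b<Da : 2 ℕ.* ∣ b ∣ ℕ.< D ℕ.* a
    2b<Da = ℕₚ.≤-<-trans (ℕₚ.m≤m+n _ w) sum<Da
    regroup : ∀ b w → b ℕ.+ (w ℕ.+ b) ≡ 2 ℕ.* b ℕ.+ w
    regroup = ℕ-solve-∀
    cancels : ∀ x b → x ≡ x ℤ.+ b ℤ.- b
    cancels = ℤ-solve-∀

  growthThreshold : ℕ
  growthThreshold = suc (2 ℕ.* ∣ b ∣ ℕ.+ suc (2 ℕ.* E))

  ∣f∣-mono : ∀ {a u} → growthThreshold ℕ.≤ a → u ℕ.< a → ∣ evalℤ f (+ u) ∣ ℕ.< ∣ evalℤ f (+ a) ∣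
  ∣f∣-mono {a} {u} a≥ u<a = ℕₚ.*-cancelˡ-< (D ℕ.^ d) _ _ (begin-strict
    D ℕ.^ d ℕ.* ∣ evalℤ f (+ u) ∣   ≡⟨ D^d*∣f∣≡∣G∣ u ⟩
    ∣ G (var u) ∣                   <⟨ ∣G∣-mono {var u} (below u<a) w≤W ⟩
    ∣ G (+ W) ∣                     ≡⟨ cong (λ t → ∣ G t ∣) var≡W ⟨
    ∣ G (var a) ∣                   ≡⟨ D^d*∣f∣≡∣G∣ a ⟨
    D ℕ.^ d ℕ.* ∣ evalℤ f (+ a) ∣   ∎)
    where
    open ℕₚ.≤-Reasoning
    open Large (large (suc (2 ℕ.* E)) a≥)

  f-nonneg : ∀ {a} → growthThreshold ℕ.≤ a → evalℤ f (+ a) ≡ + ∣ evalℤ f (+ a) ∣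
  f-nonneg {a} a≥ = sym (ℤₚ.0≤i⇒+∣i∣≡i (ℤₚ.*-cancelˡ-≤-pos (+ 0) (evalℤ f (+ a)) (+ (D ℕ.^ d))
    {{ℤ.positive (ℤ.+<+ (ℕ.>-nonZero⁻¹ (D ℕ.^ d)))}} (begin
    + (D ℕ.^ d) ℤ.* + 0            ≡⟨ ℤₚ.*-zeroʳ (+ (D ℕ.^ d)) ⟩
    + 0                            ≤⟨ +≤+ z≤n ⟩
    + ∣ G (+ W) ∣                  ≡⟨ G-nonneg (ℕₚ.≤-trans (s≤s (ℕₚ.m≤m+n E _)) w≤W) ⟨
    G (+ W)                        ≡⟨ cong G var≡W ⟨
    G (var a)                      ≡⟨ D^d*f≡G a ⟨
    + (D ℕ.^ d) ℤ.* evalℤ f (+ a)  ∎)))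
    where
    open ℤₚ.≤-Reasoning
    open Large (large (suc (2 ℕ.* E)) a≥)

  module Gap (K gap : ℕ) where

    private
      -- A shift of a by at most `gap` moves `var a` by at most `p̄`. `C` collects the errors of the
      -- two leading terms, each weighted by at most K. The first summand of `extra` makes ∣ var u ∣
      -- large enough to determine signs; the second is the bound on W that `homothety-bound` will
      -- contradict.
      p̄ C c extra : ℕ
      p̄ = D ℕ.* gap
      C = 2 ℕ.* K ℕ.* E
      c = 2 ℕ.* K
      extra = c ℕ.* (E ℕ.+ ∣ b ∣) ℕ.+ E ℕ.* p̄ ℕ.^ d

    open PowerGap n K p̄ C using (threshold; w≤cu; proportional)

    gapThreshold : ℕ
    gapThreshold = suc (2 ℕ.* ∣ b ∣ ℕ.+ suc (threshold ℕ.+ extra))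

    module _ {k j} (j<k : j ℕ.< k) (k≤K : k ℕ.≤ K) (1≤j : 1 ℕ.≤ j) where

      private
        instance
          k≢0 : NonZero k
          k≢0 = ℕ.>-nonZero (ℕₚ.≤-trans (s≤s z≤n) j<k)

      powers-close : ∀ {X W} → ∣ X ∣ ℕ.≤ W → 1 ℕ.≤ W → k ℕ.* ∣ G X ∣ ≡ j ℕ.* ∣ G (+ W) ∣ →
        ℕ.∣ k ℕ.* ∣ X ∣ ℕ.^ d - j ℕ.* W ℕ.^ d ∣ ℕ.≤ C ℕ.* W ℕ.^ n
      powers-close {X} {W} X≤W 1≤W eq = begin
        ℕ.∣ k ℕ.* x - j ℕ.* y ∣
          ≤⟨ ℕₚ.m≤n*m _ l ⟩
        l ℕ.* ℕ.∣ k ℕ.* x - j ℕ.* y ∣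
          ≡⟨ ℕₚ.*-distribˡ-∣-∣ l (k ℕ.* x) (j ℕ.* y) ⟩
        ℕ.∣ l ℕ.* (k ℕ.* x) - l ℕ.* (j ℕ.* y) ∣
          ≡⟨ cong₂ ℕ.∣_-_∣ (swap l k x) (swap l j y) ⟩
        ℕ.∣ k ℕ.* (l ℕ.* x) - j ℕ.* (l ℕ.* y) ∣
          ≤⟨ ℕₚ.∣-∣-triangle (k ℕ.* (l ℕ.* x)) (k ℕ.* ∣ G X ∣) (j ℕ.* (l ℕ.* y)) ⟩
        ℕ.∣ k ℕ.* (l ℕ.* x) - k ℕ.* ∣ G X ∣ ∣ ℕ.+ ℕ.∣ k ℕ.* ∣ G X ∣ - j ℕ.* (l ℕ.* y) ∣
          ≡⟨ cong₂ (λ s t → s ℕ.+ ℕ.∣ t - j ℕ.* (l ℕ.* y) ∣) (ℕₚ.∣-∣-comm (k ℕ.* (l ℕ.* x)) (k ℕ.* ∣ G X ∣)) eq ⟩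
        ℕ.∣ k ℕ.* ∣ G X ∣ - k ℕ.* (l ℕ.* x) ∣ ℕ.+ ℕ.∣ j ℕ.* ∣ G (+ W) ∣ - j ℕ.* (l ℕ.* y) ∣
          ≡⟨ cong₂ ℕ._+_ (ℕₚ.*-distribˡ-∣-∣ k ∣ G X ∣ (l ℕ.* x)) (ℕₚ.*-distribˡ-∣-∣ j ∣ G (+ W) ∣ (l ℕ.* y)) ⟨
        k ℕ.* ℕ.∣ ∣ G X ∣ - l ℕ.* x ∣ ℕ.+ j ℕ.* ℕ.∣ ∣ G (+ W) ∣ - l ℕ.* y ∣
          ≤⟨ ℕₚ.+-mono-≤ (ℕₚ.*-mono-≤ k≤K (G-close {X} X≤W 1≤W))
                         (ℕₚ.*-mono-≤ (ℕₚ.≤-trans (ℕₚ.<⇒≤ j<k) k≤K) (G-close {+ W} ℕₚ.≤-refl 1≤W)) ⟩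
        K ℕ.* (E ℕ.* W ℕ.^ n) ℕ.+ K ℕ.* (E ℕ.* W ℕ.^ n)
          ≡⟨ collect K E (W ℕ.^ n) ⟩
        C ℕ.* W ℕ.^ n ∎
        where
        open ℕₚ.≤-Reasoning
        x = ∣ X ∣ ℕ.^ d
        y = W ℕ.^ d
        swap : ∀ a b c → a ℕ.* (b ℕ.* c) ≡ b ℕ.* (a ℕ.* c)
        swap = ℕ-solve-∀
        collect : ∀ K E w → K ℕ.* (E ℕ.* w) ℕ.+ K ℕ.* (E ℕ.* w) ≡ 2 ℕ.* K ℕ.* E ℕ.* w
        collect = ℕ-solve-∀

      -- Once p u = q w and k qᵈ = j pᵈ, the leading terms of k G(u) = j G(w) cancel.
      lower-terms : ∀ {p q u w} → 1 ℕ.≤ p → p ℕ.* u ≡ q ℕ.* w → k ℕ.* q ℕ.^ d ≡ j ℕ.* p ℕ.^ d →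
        + k ℤ.* G (+ u) ≡ + j ℤ.* G (+ w) →
        + (p ℕ.^ d) ℤ.* evalℤ e (+ u) ≡ + (q ℕ.^ d) ℤ.* evalℤ e (+ w)
      lower-terms {p} {q} {u} {w} 1≤p pu≡qw kq≡jp eq = ℤₚ.*-cancelˡ-≡ (+ k) _ _ (begin
        + k ℤ.* (+ (p ℕ.^ d) ℤ.* eu)      ≡⟨ e₁ (+ k) (+ (p ℕ.^ d)) eu ⟩
        + (p ℕ.^ d) ℤ.* (+ k ℤ.* eu)      ≡⟨ cong (+ (p ℕ.^ d) ℤ.*_) keu≡jew ⟩
        + (p ℕ.^ d) ℤ.* (+ j ℤ.* ew)      ≡⟨ e₂ (+ (p ℕ.^ d)) (+ j) ew ⟩
        + j ℤ.* + (p ℕ.^ d) ℤ.* ew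
          ≡⟨ cong (ℤ._* ew) (trans (sym (ℤₚ.pos-* j (p ℕ.^ d))) (trans (cong +_ (sym kq≡jp)) (ℤₚ.pos-* k (q ℕ.^ d)))) ⟩
        + k ℤ.* + (q ℕ.^ d) ℤ.* ew        ≡⟨ ℤₚ.*-assoc (+ k) (+ (q ℕ.^ d)) ew ⟩
        + k ℤ.* (+ (q ℕ.^ d) ℤ.* ew)      ∎)
        where
        open ≡-Reasoning
        eu = evalℤ e (+ u)
        ew = evalℤ e (+ w)
        e₁ : ∀ a b c → a ℤ.* (b ℤ.* c) ≡ b ℤ.* (a ℤ.* c)
        e₁ = ℤ-solve-∀
        e₂ : ∀ a b c → a ℤ.* (b ℤ.* c) ≡ b ℤ.* a ℤ.* c
        e₂ = ℤ-solve-∀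
        e₃ : ∀ P k u → P ℕ.* (k ℕ.* u) ≡ k ℕ.* (P ℕ.* u)
        e₃ = ℕ-solve-∀
        e₄ : ∀ P j w → j ℕ.* P ℕ.* w ≡ P ℕ.* (j ℕ.* w)
        e₄ = ℕ-solve-∀
        ku≡jw : k ℕ.* u ℕ.^ d ≡ j ℕ.* w ℕ.^ d
        ku≡jw = ℕₚ.*-cancelˡ-≡ _ _ (p ℕ.^ d) {{ℕ.>-nonZero (1≤^ d 1≤p)}} (begin
          p ℕ.^ d ℕ.* (k ℕ.* u ℕ.^ d)   ≡⟨ e₃ (p ℕ.^ d) k (u ℕ.^ d) ⟩
          k ℕ.* (p ℕ.^ d ℕ.* u ℕ.^ d)   ≡⟨ cong (k ℕ.*_) (^-distribʳ-* p u d) ⟨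
          k ℕ.* (p ℕ.* u) ℕ.^ d         ≡⟨ cong (λ t → k ℕ.* t ℕ.^ d) pu≡qw ⟩
          k ℕ.* (q ℕ.* w) ℕ.^ d         ≡⟨ cong (k ℕ.*_) (^-distribʳ-* q w d) ⟩
          k ℕ.* (q ℕ.^ d ℕ.* w ℕ.^ d)   ≡⟨ ℕₚ.*-assoc k (q ℕ.^ d) (w ℕ.^ d) ⟨
          k ℕ.* q ℕ.^ d ℕ.* w ℕ.^ d     ≡⟨ cong (ℕ._* w ℕ.^ d) kq≡jp ⟩
          j ℕ.* p ℕ.^ d ℕ.* w ℕ.^ d     ≡⟨ e₄ (p ℕ.^ d) j (w ℕ.^ d) ⟩
          p ℕ.^ d ℕ.* (j ℕ.* w ℕ.^ d)   ∎)
        pow : ∀ k u → + k ℤ.* (+ u) ℤ.^ d ≡ + (k ℕ.* u ℕ.^ d)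
        pow k u = trans (cong (+ k ℤ.*_) (sym (pos-^ u d))) (sym (ℤₚ.pos-* k (u ℕ.^ d)))
        split : ∀ k l u E → k ℤ.* E ≡ k ℤ.* (l ℤ.* u ℤ.+ E) ℤ.- l ℤ.* (k ℤ.* u)
        split = ℤ-solve-∀
        keu≡jew : + k ℤ.* eu ≡ + j ℤ.* ew
        keu≡jew = begin
          + k ℤ.* eu                                          ≡⟨ split (+ k) (+ l) ((+ u) ℤ.^ d) eu ⟩
          + k ℤ.* G (+ u) ℤ.- + l ℤ.* (+ k ℤ.* (+ u) ℤ.^ d)
            ≡⟨ cong₂ (λ s t → s ℤ.- + l ℤ.* t) eq (trans (pow k u) (trans (cong +_ ku≡jw) (sym (pow j w)))) ⟩
          + j ℤ.* G (+ w) ℤ.- + l ℤ.* (+ j ℤ.* (+ w) ℤ.^ d)   ≡⟨ split (+ j) (+ l) ((+ w) ℤ.^ d) ew ⟨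
          + j ℤ.* ew                                          ∎

      -- q / p is the d-th root of j / k, and 0 < j < k; the homothety is thus a genuine
      -- contraction.
      ratio<1 : ∀ {p q} → 1 ℕ.≤ p → k ℕ.* q ℕ.^ d ≡ j ℕ.* p ℕ.^ d → 1 ℕ.≤ q × q ℕ.< p
      ratio<1 {p} {q} 1≤p eq = ℕₚ.n≢0⇒n>0 q≢0 , ℕₚ.≰⇒> λ p≤q → ℕₚ.<⇒≢ (begin-strict
        j ℕ.* p ℕ.^ d   <⟨ ℕₚ.*-monoˡ-< (p ℕ.^ d) {{ℕ.>-nonZero (1≤^ d 1≤p)}} j<k ⟩
        k ℕ.* p ℕ.^ d   ≤⟨ ℕₚ.*-monoʳ-≤ k (ℕₚ.^-monoˡ-≤ d p≤q) ⟩
        k ℕ.* q ℕ.^ d   ∎) (sym eq)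
        where
        open ℕₚ.≤-Reasoning
        q≢0 : q ≢ 0
        q≢0 refl = ℕₚ.<⇒≢ (ℕₚ.*-mono-≤ 1≤j (1≤^ d 1≤p)) (trans (sym (ℕₚ.*-zeroʳ k)) eq)

      -- The second solution supplies the slope q / p, and `proportional` puts the first one exactly
      -- on the line p u = q w. There the leading terms cancel, so e obeys the homothety identity;
      -- as e is nonzero, W is at most E pᵈ, against the choice of `extra`.
      no-close-pair : ∀ {a u r u′} → gapThreshold ℕ.≤ a → 1 ℕ.≤ r → r ℕ.≤ gap →
        u ℕ.< a → k ℕ.* ∣ evalℤ f (+ u) ∣ ≡ j ℕ.* ∣ evalℤ f (+ a) ∣ →
        u′ ℕ.< a ℕ.+ r → k ℕ.* ∣ evalℤ f (+ u′) ∣ ≡ j ℕ.* ∣ evalℤ f (+ (a ℕ.+ r)) ∣ → ⊥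
      no-close-pair {a} {u} {r} {u′} a≥ 1≤r r≤gap u<a eq u′<a+r eq′ = contradict
        (proportional {k} {j} {W} k≤K 1≤k 1≤j threshold≤W {∣ var u ∣} {∣ var u′ ∣} {p} 1≤p p≤p̄ close close′ (ℕₚ.<⇒≤ U<W))
        where
        open Large (large (suc (threshold ℕ.+ extra)) a≥)
        open Large (large (suc (threshold ℕ.+ extra)) (ℕₚ.≤-trans a≥ (ℕₚ.m≤m+n a r)))
          renaming (W to W′; var≡W to var≡W′; w≤W to w≤W′; below to below′)
        p = D ℕ.* r
        1≤k : 1 ℕ.≤ k
        1≤k = ℕₚ.≤-trans (s≤s z≤n) j<k
        1≤p : 1 ℕ.≤ p
        1≤p = ℕₚ.*-mono-≤ 1≤D 1≤r
        p≤p̄ : p ℕ.≤ p̄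
        p≤p̄ = ℕₚ.*-monoʳ-≤ D r≤gap
        1≤W : 1 ℕ.≤ W
        1≤W = ℕₚ.≤-trans (s≤s z≤n) w≤W
        U<W : ∣ var u ∣ ℕ.< W
        U<W = below u<a
        threshold≤W : threshold ℕ.≤ W
        threshold≤W = ℕₚ.≤-trans (ℕₚ.m≤m+n threshold (suc extra)) (ℕₚ.≤-trans (ℕₚ.≤-reflexive (ℕₚ.+-suc threshold extra)) w≤W)
        extra<W : extra ℕ.< W
        extra<W = ℕₚ.≤-trans (s≤s (ℕₚ.m≤n+m extra threshold)) w≤W
        W′≡W+p : W′ ≡ W ℕ.+ p
        W′≡W+p = ℤₚ.+-injective (begin
          + W′                                ≡⟨ var≡W′ ⟨
          + (D ℕ.* (a ℕ.+ r)) ℤ.+ b           ≡⟨ cong (λ t → + t ℤ.+ b) (ℕₚ.*-distribˡ-+ D a r) ⟩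
          + (D ℕ.* a ℕ.+ p) ℤ.+ b             ≡⟨ cong (ℤ._+ b) (ℤₚ.pos-+ (D ℕ.* a) p) ⟩
          + (D ℕ.* a) ℤ.+ + p ℤ.+ b           ≡⟨ shift (+ (D ℕ.* a)) (+ p) b ⟩
          var a ℤ.+ + p                       ≡⟨ cong (ℤ._+ + p) var≡W ⟩
          + W ℤ.+ + p                         ≡⟨ ℤₚ.pos-+ W p ⟨
          + (W ℕ.+ p)                         ∎)
          where
          open ≡-Reasoning
          shift : ∀ x p b → x ℤ.+ p ℤ.+ b ≡ x ℤ.+ b ℤ.+ p
          shift = ℤ-solve-∀
        scale : ∀ {a u W} → var a ≡ + W → k ℕ.* ∣ evalℤ f (+ u) ∣ ≡ j ℕ.* ∣ evalℤ f (+ a) ∣ →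
          k ℕ.* ∣ G (var u) ∣ ≡ j ℕ.* ∣ G (+ W) ∣
        scale {a} {u} {W} var≡W eq = begin
          k ℕ.* ∣ G (var u) ∣                          ≡⟨ cong (k ℕ.*_) (D^d*∣f∣≡∣G∣ u) ⟨
          k ℕ.* (D ℕ.^ d ℕ.* ∣ evalℤ f (+ u) ∣)        ≡⟨ swap k (D ℕ.^ d) ∣ evalℤ f (+ u) ∣ ⟩
          D ℕ.^ d ℕ.* (k ℕ.* ∣ evalℤ f (+ u) ∣)        ≡⟨ cong (D ℕ.^ d ℕ.*_) eq ⟩
          D ℕ.^ d ℕ.* (j ℕ.* ∣ evalℤ f (+ a) ∣)        ≡⟨ swap (D ℕ.^ d) j ∣ evalℤ f (+ a) ∣ ⟩
          j ℕ.* (D ℕ.^ d ℕ.* ∣ evalℤ f (+ a) ∣)        ≡⟨ cong (j ℕ.*_) (trans (D^d*∣f∣≡∣G∣ a) (cong (λ t → ∣ G t ∣) var≡W)) ⟩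
          j ℕ.* ∣ G (+ W) ∣                            ∎
          where
          open ≡-Reasoning
          swap : ∀ a b c → a ℕ.* (b ℕ.* c) ≡ b ℕ.* (a ℕ.* c)
          swap = ℕ-solve-∀
        close : ℕ.∣ k ℕ.* ∣ var u ∣ ℕ.^ d - j ℕ.* W ℕ.^ d ∣ ℕ.≤ C ℕ.* W ℕ.^ n
        close = powers-close {var u} (ℕₚ.<⇒≤ U<W) 1≤W (scale {a} {u} var≡W eq)
        close′ : ℕ.∣ k ℕ.* ∣ var u′ ∣ ℕ.^ d - j ℕ.* (W ℕ.+ p) ℕ.^ d ∣ ℕ.≤ C ℕ.* (W ℕ.+ p) ℕ.^ n
        close′ = subst (λ t → ℕ.∣ k ℕ.* ∣ var u′ ∣ ℕ.^ d - j ℕ.* t ℕ.^ d ∣ ℕ.≤ C ℕ.* t ℕ.^ n) W′≡W+p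
          (powers-close {var u′} (ℕₚ.<⇒≤ (below′ u′<a+r)) (ℕₚ.≤-trans (s≤s z≤n) w≤W′) (scale {a ℕ.+ r} {u′} var≡W′ eq′))
        -- From W ≤ c ∣ var u ∣. Exceeding ∣ b ∣ makes `var u` positive, and exceeding E makes G
        -- nonnegative there, so the equation between absolute values becomes the signed equation
        -- `signed`.
        E+b<U : E ℕ.+ ∣ b ∣ ℕ.< ∣ var u ∣
        E+b<U = ℕₚ.*-cancelˡ-< c _ _ (ℕₚ.≤-<-trans (ℕₚ.m≤m+n _ (E ℕ.* p̄ ℕ.^ d))
          (ℕₚ.<-≤-trans extra<W (w≤cu {k} {j} {W} k≤K 1≤k 1≤j threshold≤W {∣ var u ∣} close)))
        var-u≡ : var u ≡ + ∣ var u ∣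
        var-u≡ = ∣j∣<∣m+j∣⇒m+j≡∣m+j∣ (D ℕ.* u) b (ℕₚ.≤-<-trans (ℕₚ.m≤n+m ∣ b ∣ E) E+b<U)
        E<U : E ℕ.< ∣ var u ∣
        E<U = ℕₚ.≤-<-trans (ℕₚ.m≤m+n E ∣ b ∣) E+b<U
        signed : + k ℤ.* G (+ ∣ var u ∣) ≡ + j ℤ.* G (+ W)
        signed = begin
          + k ℤ.* G (+ ∣ var u ∣)          ≡⟨ cong (+ k ℤ.*_) (G-nonneg E<U) ⟩
          + k ℤ.* + ∣ G (+ ∣ var u ∣) ∣    ≡⟨ ℤₚ.pos-* k _ ⟨
          + (k ℕ.* ∣ G (+ ∣ var u ∣) ∣)    ≡⟨ cong (λ t → + (k ℕ.* ∣ G t ∣)) var-u≡ ⟨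
          + (k ℕ.* ∣ G (var u) ∣)          ≡⟨ cong +_ (scale {a} {u} var≡W eq) ⟩
          + (j ℕ.* ∣ G (+ W) ∣)            ≡⟨ ℤₚ.pos-* j _ ⟩
          + j ℤ.* + ∣ G (+ W) ∣            ≡⟨ cong (+ j ℤ.*_) (G-nonneg (ℕₚ.<-trans E<U U<W)) ⟨
          + j ℤ.* G (+ W)                  ∎
          where open ≡-Reasoning
        contradict : ∃[ q ] ∣ var u′ ∣ ≡ ∣ var u ∣ ℕ.+ q × k ℕ.* q ℕ.^ d ≡ j ℕ.* p ℕ.^ d × p ℕ.* ∣ var u ∣ ≡ q ℕ.* W → ⊥
        contradict (q , _ , kq≡jp , pu≡qw) = [ e≢0 , (λ W≤ → ℕₚ.<⇒≱ extra<W (ℕₚ.≤-trans W≤ E*p^d≤extra)) ]′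
          (homothety-bound e d {p} {q} {∣ var u ∣} {W} (ℕₚ.≤-reflexive (cong suc len-e)) (proj₁ q-bounds) (proj₂ q-bounds) 1≤W pu≡qw
            (lower-terms {p} {q} {∣ var u ∣} {W} 1≤p pu≡qw kq≡jp signed))
          where
          q-bounds : 1 ℕ.≤ q × q ℕ.< p
          q-bounds = ratio<1 {p} {q} 1≤p kq≡jp
          E*p^d≤extra : E ℕ.* p ℕ.^ d ℕ.≤ extra
          E*p^d≤extra = ℕₚ.≤-trans (ℕₚ.*-monoʳ-≤ E (ℕₚ.^-monoˡ-≤ d p≤p̄)) (ℕₚ.m≤n+m _ (c ℕ.* (E ℕ.+ ∣ b ∣)))

-- From an earlier integral value to a square divisor of h

coprime-*ʳ : ∀ {k x y} → Coprime k x → Coprime k y → Coprime k (x ℕ.* y)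
coprime-*ʳ k⊥x k⊥y (d∣k , d∣xy) =
  k⊥y (d∣k , coprime-divisor (λ (c∣d , c∣x) → k⊥x (∣-trans c∣d d∣k , c∣x)) d∣xy)

coprime-^ʳ : ∀ {k x} m → Coprime k x → Coprime k (x ℕ.^ m)
coprime-^ʳ {k} zero    k⊥x = Coprime.sym (1-coprimeTo k)
coprime-^ʳ     (suc m) k⊥x = coprime-*ʳ k⊥x (coprime-^ʳ m k⊥x)

-- k/j is y/x in lowest terms, so that even k^(m+2) divides h.
square-divisor : ∀ {h x y s} m → h ℕ.* x ℕ.^ (2 ℕ.+ m) ≡ s ℕ.* y ℕ.^ (2 ℕ.+ m) → 1 ℕ.≤ s → x ℕ.< y →
  ∃[ k ] ∃[ j ] k ℕ.* x ≡ j ℕ.* y × 1 ℕ.≤ j × j ℕ.< k × k ℕ.* k ∣ h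
square-divisor {h} {x} {y} {s} m eq 1≤s x<y = k , j , kx≡jy , ℕₚ.n≢0⇒n>0 j≢0 , j<k , k²∣h
  where
  M = 2 ℕ.+ m
  g = gcd x y
  1≤y : 1 ℕ.≤ y
  1≤y = ℕₚ.≤-trans (s≤s z≤n) x<y
  instance
    g≢0 : NonZero g
    g≢0 = ℕ.≢-nonZero (gcd[m,n]≢0 x y (inj₂ (ℕₚ.n>0⇒n≢0 1≤y)))
    g^M≢0 : NonZero (g ℕ.^ M)
    g^M≢0 = ℕₚ.m^n≢0 g M
  k = y / g
  j = x / g
  jg≡x : j ℕ.* g ≡ x
  jg≡x = m/n*n≡m (gcd[m,n]∣m x y)
  kg≡y : k ℕ.* g ≡ y
  kg≡y = m/n*n≡m (gcd[m,n]∣n x y)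
  j⊥k : Coprime j k
  j⊥k = coprime-/gcd x y
  kx≡jy : k ℕ.* x ≡ j ℕ.* y
  kx≡jy = trans (cong (k ℕ.*_) (sym jg≡x)) (trans (swap k j g) (cong (j ℕ.*_) kg≡y))
    where
    swap : ∀ a b c → a ℕ.* (b ℕ.* c) ≡ b ℕ.* (a ℕ.* c)
    swap = ℕ-solve-∀
  j<k : j ℕ.< k
  j<k = ℕₚ.*-cancelʳ-< g j k (subst₂ ℕ._<_ (sym jg≡x) (sym kg≡y) x<y)
  reduced : h ℕ.* j ℕ.^ M ≡ s ℕ.* k ℕ.^ M
  reduced = ℕₚ.*-cancelʳ-≡ _ _ (g ℕ.^ M) (begin
    h ℕ.* j ℕ.^ M ℕ.* g ℕ.^ M      ≡⟨ ℕₚ.*-assoc h _ _ ⟩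
    h ℕ.* (j ℕ.^ M ℕ.* g ℕ.^ M)    ≡⟨ cong (h ℕ.*_) (trans (sym (^-distribʳ-* j g M)) (cong (ℕ._^ M) jg≡x)) ⟩
    h ℕ.* x ℕ.^ M                  ≡⟨ eq ⟩
    s ℕ.* y ℕ.^ M                  ≡⟨ cong (s ℕ.*_) (trans (sym (^-distribʳ-* k g M)) (cong (ℕ._^ M) kg≡y)) ⟨
    s ℕ.* (k ℕ.^ M ℕ.* g ℕ.^ M)    ≡⟨ ℕₚ.*-assoc s _ _ ⟨
    s ℕ.* k ℕ.^ M ℕ.* g ℕ.^ M      ∎)
    where open ≡-Reasoning
  j≢0 : j ≢ 0
  j≢0 j≡0 = ℕₚ.<⇒≢ (ℕₚ.*-mono-≤ 1≤s (1≤^ M 1≤k)) (trans (sym (trans (cong (λ t → h ℕ.* t ℕ.^ M) j≡0) (ℕₚ.*-zeroʳ h))) reduced)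
    where
    1≤k : 1 ℕ.≤ k
    1≤k = ℕₚ.≤-trans (s≤s z≤n) j<k
  k²∣h : k ℕ.* k ∣ h
  k²∣h = coprime-divisor (coprime-^ʳ M (Coprime.sym (coprime-*ʳ j⊥k j⊥k)))
    (divides (s ℕ.* k ℕ.^ m) (trans (ℕₚ.*-comm (j ℕ.^ M) h) (trans reduced (regroup s k (k ℕ.^ m)))))
    where
    regroup : ∀ s k κ → s ℕ.* (k ℕ.* (k ℕ.* κ)) ≡ s ℕ.* κ ℕ.* (k ℕ.* k)
    regroup = ℕ-solve-∀

-- The condition h = t F(a) forces t = h / f(a)^M. An earlier value t F(u) = s + 1 then gives h
-- f(u)^M = (s + 1) f(a)^M, and taking absolute values brings it into the form that `square-divisor`
-- treats.
visible-unless-square-divisor : ∀ f m a {h} → 1 ℕ.≤ h → evalℤ f (+ a) ≡ + ∣ evalℤ f (+ a) ∣ → 1 ℕ.≤ ∣ evalℤ f (+ a) ∣ →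
  (∀ {u} → u ℕ.< a → ∣ evalℤ f (+ u) ∣ ℕ.< ∣ evalℤ f (+ a) ∣) →
  (∀ {u k j} → u ℕ.< a → k ℕ.* ∣ evalℤ f (+ u) ∣ ≡ j ℕ.* ∣ evalℤ f (+ a) ∣ → 1 ℕ.≤ j → j ℕ.< k → k ℕ.* k ∣ h → ⊥) →
  VisibleAlong (λ x → evalℤ f x ℤ.^ (2 ℕ.+ m)) a h
visible-unless-square-divisor f m a {h@(suc h-1)} _ nonneg 1≤y mono impossible = t , sym tF≡h , (h-1 , tF≡h) , not-earlier
  where
  M = 2 ℕ.+ m
  y = ∣ evalℤ f (+ a) ∣
  F : ℕ → ℤ
  F u = evalℤ f (+ u) ℤ.^ M
  instance
    y≢0 : NonZero y
    y≢0 = ℕ.>-nonZero 1≤y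
    y^M≢0 : NonZero (y ℕ.^ M)
    y^M≢0 = ℕₚ.m^n≢0 y M
  t : ℚ
  t = + h ℚ./ (y ℕ.^ M)
  Fa≡y^M : F a ≡ + (y ℕ.^ M)
  Fa≡y^M = trans (cong (ℤ._^ M) nonneg) (sym (pos-^ y M))
  t*y^M≡h : t ℚ.* ι (+ (y ℕ.^ M)) ≡ ι (+ h)
  t*y^M≡h = /-*-cancel (+ h) (y ℕ.^ M)
  tF≡h : t ℚ.* ι (F a) ≡ ι (+ h)
  tF≡h = trans (cong (λ z → t ℚ.* ι z) Fa≡y^M) t*y^M≡h
  not-earlier : (u : ℕ) → 0 ℕ.< u → u ℕ.< a → ¬ IsPosInt (t ℚ.* ι (F u))
  not-earlier u _ u<a (s , tFu≡s) = conclude (square-divisor {h} {∣ evalℤ f (+ u) ∣} {y} {suc s} m over-ℕ (s≤s z≤n) (mono u<a))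
    where
    over-ℤ : + h ℤ.* F u ≡ + suc s ℤ.* + (y ℕ.^ M)
    over-ℤ = ι-injective (begin
      ι (+ h ℤ.* F u)                            ≡⟨ ι-* (+ h) (F u) ⟩
      ι (+ h) ℚ.* ι (F u)                        ≡⟨ cong (ℚ._* ι (F u)) t*y^M≡h ⟨
      t ℚ.* ι (+ (y ℕ.^ M)) ℚ.* ι (F u)          ≡⟨ solve 3 (λ a b c → a :* b :* c := a :* c :* b) refl t (ι (+ (y ℕ.^ M))) (ι (F u)) ⟩
      t ℚ.* ι (F u) ℚ.* ι (+ (y ℕ.^ M))          ≡⟨ cong (ℚ._* ι (+ (y ℕ.^ M))) tFu≡s ⟩
      ι (+ suc s) ℚ.* ι (+ (y ℕ.^ M))            ≡⟨ ι-* (+ suc s) (+ (y ℕ.^ M)) ⟨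
      ι (+ suc s ℤ.* + (y ℕ.^ M))                ∎)
      where
      open ≡-Reasoning
      open +-*-Solver
    over-ℕ : h ℕ.* ∣ evalℤ f (+ u) ∣ ℕ.^ M ≡ suc s ℕ.* y ℕ.^ M
    over-ℕ = begin
      h ℕ.* ∣ evalℤ f (+ u) ∣ ℕ.^ M      ≡⟨ cong (h ℕ.*_) (∣i^n∣≡∣i∣^n (evalℤ f (+ u)) M) ⟨
      h ℕ.* ∣ F u ∣                      ≡⟨ ℤₚ.∣i*j∣≡∣i∣*∣j∣ (+ h) (F u) ⟨
      ∣ + h ℤ.* F u ∣                    ≡⟨ cong ∣_∣ over-ℤ ⟩
      ∣ + suc s ℤ.* + (y ℕ.^ M) ∣        ≡⟨ ℤₚ.∣i*j∣≡∣i∣*∣j∣ (+ suc s) (+ (y ℕ.^ M)) ⟩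
      suc s ℕ.* y ℕ.^ M                  ∎
      where open ≡-Reasoning
    conclude : ∃[ k ] ∃[ j ] k ℕ.* ∣ evalℤ f (+ u) ∣ ≡ j ℕ.* y × 1 ℕ.≤ j × j ℕ.< k × k ℕ.* k ∣ h → ⊥
    conclude (k , j , kx≡jy , 1≤j , j<k , k²∣h) = impossible u<a kx≡jy 1≤j j<k k²∣h

-- Passage to the density

-- A positive ε is at least 1 / q for its denominator q, so it suffices that the missing proportion
-- m / Q lies below 1 / q.
close-to-1 : ∀ {c m Q} ε → .{{_ : NonZero Q}} → 0ℚ ℚ.< ε → c ℕ.+ m ≡ Q → m ℕ.* ℚ.denominatorℕ ε ℕ.< Q →
  ℚ.∣ (+ c ℚ./ Q) ℚ.- 1ℚ ∣ ℚ.< ε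
close-to-1 (mkℚ (+ zero) q-1 _) (ℚ.*<* (ℤ.+<+ ())) _ _
close-to-1 (mkℚ -[1+ _ ] q-1 _) (ℚ.*<* ()) _ _
close-to-1 {c} {m} {Q@(suc Q-1)} ε@(mkℚ (+ suc p) q-1 _) 0<ε c+m≡Q mq<Q = ℚₚ.toℚᵘ-cancel-< (begin-strict
  toℚᵘ ℚ.∣ r ℚ.- 1ℚ ∣                   ≃⟨ ℚₚ.toℚᵘ-homo-∣-∣ (r ℚ.- 1ℚ) ⟩
  ℚᵘ.∣ toℚᵘ (r ℚ.- 1ℚ) ∣                ≃⟨ ℚᵘₚ.∣-∣-cong (ℚₚ.toℚᵘ-homo-+ r (ℚ.- 1ℚ)) ⟩
  ℚᵘ.∣ toℚᵘ r ℚᵘ.- ℚᵘ.1ℚᵘ ∣             ≃⟨ ℚᵘₚ.∣-∣-cong (ℚᵘₚ.+-congˡ (ℚᵘ.- ℚᵘ.1ℚᵘ) (ℚₚ.toℚᵘ-fromℚᵘ (mkℚᵘ (+ c) Q-1))) ⟩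
  ℚᵘ.∣ mkℚᵘ (+ c) Q-1 ℚᵘ.- ℚᵘ.1ℚᵘ ∣     <⟨ *<* numerators ⟩
  toℚᵘ ε                                ∎)
  where
  open ℚᵘₚ.≤-Reasoning
  r = + c ℚ./ Q
  1-r≡m/Q : ∀ c m → + c ℤ.* + 1 ℤ.+ ℤ.- + 1 ℤ.* (+ c ℤ.+ + m) ≡ ℤ.- + m
  1-r≡m/Q c m = cancels (+ c) (+ m)
    where
    cancels : ∀ c m → c ℤ.* + 1 ℤ.+ ℤ.- + 1 ℤ.* (c ℤ.+ m) ≡ ℤ.- m
    cancels = ℤ-solve-∀
  numerator≡m : ∣ + c ℤ.* + 1 ℤ.+ ℤ.- + 1 ℤ.* + Q ∣ ≡ m
  numerator≡m = trans (cong (λ t → ∣ + c ℤ.* + 1 ℤ.+ ℤ.- + 1 ℤ.* t ∣) (trans (cong +_ (sym c+m≡Q)) (ℤₚ.pos-+ c m)))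
    (trans (cong ∣_∣ (1-r≡m/Q c m)) (ℤₚ.∣-i∣≡∣i∣ (+ m)))
  numerators : + ∣ + c ℤ.* + 1 ℤ.+ ℤ.- + 1 ℤ.* + Q ∣ ℤ.* + suc q-1 ℤ.< + suc p ℤ.* + (Q ℕ.* 1)
  numerators = subst₂ ℤ._<_
    (trans (ℤₚ.pos-* m (suc q-1)) (cong (λ t → + t ℤ.* + suc q-1) (sym numerator≡m)))
    (ℤₚ.pos-* (suc p) (Q ℕ.* 1))
    (ℤ.+<+ (ℕₚ.<-≤-trans mq<Q (ℕₚ.≤-trans (ℕₚ.≤-reflexive (sym (ℕₚ.*-identityʳ Q))) (ℕₚ.m≤n*m (Q ℕ.* 1) (suc p)))))

-- ε determines K, then `gap`, and only then is A obtained; N₀ comes last and absorbs both A and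
-- `gap`.
density-1 : ∀ {P} (dec : ∀ a h → Dec (P a h)) → (∀ K gap → Exceptions P K gap) → HasDensity P dec 1ℚ
density-1 {P} dec exceptions ε 0<ε = 4 ℕ.* q ℕ.* Exceptions.A ex ℕ.+ gap , λ n N₀≤n →
  close-to-1 {count P dec (suc n)} {suc n ℕ.* suc n ℕ.∸ count P dec (suc n)} ε 0<ε
    (ℕₚ.m+[n∸m]≡n (count≤N² dec ex (suc n)))
    (missing-bound dec ex (suc n) q refl refl (s≤s N₀≤n))
  where
  q K gap : ℕ
  q = ℚ.denominatorℕ ε
  K = 4 ℕ.* q
  gap = 4 ℕ.* q ℕ.* (suc K ℕ.* suc K)
  ex : Exceptions P K gap
  ex = exceptions K gap

module _ (f e : Poly) (n l D : ℕ) (b : ℤ) (1≤l : 1 ≤ l) (1≤D : 1 ≤ D)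
  (len-e : length e ≡ suc n) (e≢0 : ¬ All (_≡ + 0) e)
  (depressed : ∀ x → + (D ℕ.^ (2 ℕ.+ n)) ℤ.* evalℤ f x ≡
                     + l ℤ.* (+ D ℤ.* x ℤ.+ b) ^ (2 ℕ.+ n) ℤ.+ evalℤ e (+ D ℤ.* x ℤ.+ b))
  where

  open Growth f e n l D b 1≤l 1≤D len-e e≢0 depressed using (growthThreshold; ∣f∣-mono; f-nonneg; module Gap)

  visibility-exceptions : ∀ m K gap → Exceptions (VisibleAlong (λ x → evalℤ f x ^ (2 ℕ.+ m))) K gap
  visibility-exceptions m K gap = record
    { A      = growthThreshold ℕ.+ gapThreshold
    ; S      = S
    ; S?     = λ k j a → gapThreshold ℕ.≤? a ×-dec 1 ℕ.≤? j ×-dec j ℕ.<? k ×-dec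
                 ℕₚ.anyUpTo? (λ u → k ℕ.* ∣ evalℤ f (+ u) ∣ ℕ.≟ j ℕ.* ∣ evalℤ f (+ a) ∣) a
    ; sparse = sparse
    ; covers = covers
    }
    where
    open Gap K gap using (gapThreshold; no-close-pair)
    -- Including `gapThreshold` ≤ a makes the spacing hold from the first element on, and the bound
    -- u < a makes S decidable by finite search.
    S : ℕ → ℕ → ℕ → Set
    S k j a = gapThreshold ≤ a × 1 ≤ j × j ℕ.< k ×
      ∃[ u ] u ℕ.< a × k ℕ.* ∣ evalℤ f (+ u) ∣ ≡ j ℕ.* ∣ evalℤ f (+ a) ∣
    sparse : ∀ {k j} → k ≤ K → ∀ {a a′} → a ℕ.< a′ → S k j a → S k j a′ → a ℕ.+ gap ≤ a′
    sparse {k} {j} k≤K {a} {a′} a<a′ (a≥ , 1≤j , j<k , u , u<a , eq) (_ , _ , _ , u′ , u′<a′ , eq′) = ℕₚ.≮⇒≥ λ a′<a+gap →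
      no-close-pair j<k k≤K 1≤j {a} {u} {a′ ℕ.∸ a} {u′} a≥ (ℕₚ.m<n⇒0<n∸m a<a′) (ℕₚ.m≤n+o⇒m∸n≤o a′ a (ℕₚ.<⇒≤ a′<a+gap))
        u<a eq (subst (u′ ℕ.<_) (sym a+r≡a′) u′<a′)
        (subst (λ t → k ℕ.* ∣ evalℤ f (+ u′) ∣ ≡ j ℕ.* ∣ evalℤ f (+ t) ∣) (sym a+r≡a′) eq′)
      where
      a+r≡a′ : a ℕ.+ (a′ ℕ.∸ a) ≡ a′
      a+r≡a′ = ℕₚ.m+[n∸m]≡n (ℕₚ.<⇒≤ a<a′)
    covers : ∀ {a h} → growthThreshold ℕ.+ gapThreshold ≤ a → 1 ≤ h → (∀ {k j} → k ≤ K → j ≤ K → ¬ S k j a) →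
      (∀ {k} → K ℕ.< k → ¬ (k ℕ.* k ∣ h)) → VisibleAlong (λ x → evalℤ f x ^ (2 ℕ.+ m)) a h
    covers {a} {h} a≥ 1≤h ¬S ¬square = visible-unless-square-divisor f m a 1≤h (f-nonneg a≥growth) 1≤∣fa∣ (∣f∣-mono a≥growth)
      -- The split at K: k > K contradicts `¬square`, while for k ≤ K the column a lies in S k j,
      -- whatever h is.
      λ {u} {k} {j} u<a eq 1≤j j<k k²∣h → ¬S {k} {j}
        (ℕₚ.≮⇒≥ λ K<k → ¬square K<k k²∣h)
        (ℕₚ.≤-trans (ℕₚ.<⇒≤ j<k) (ℕₚ.≮⇒≥ λ K<k → ¬square K<k k²∣h))
        (ℕₚ.≤-trans (ℕₚ.m≤n+m gapThreshold growthThreshold) a≥ , 1≤j , j<k , u , u<a , eq)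
      where
      a≥growth : growthThreshold ≤ a
      a≥growth = ℕₚ.≤-trans (ℕₚ.m≤m+n growthThreshold gapThreshold) a≥
      1≤∣fa∣ : 1 ≤ ∣ evalℤ f (+ a) ∣
      1≤∣fa∣ = ℕₚ.≤-<-trans z≤n (∣f∣-mono {a} {0} a≥growth (ℕₚ.≤-trans (s≤s z≤n) a≥growth))

theorem1p2 : (f : Poly) (d : ℕ) (lc : ℤ) → 2 ≤ d → HasDegreeAndLC f d lc →
    ¬ HasSingleRoot f d lc → (m : ℕ) → 2 ≤ m →
    (dec : ∀ a h → Dec (VisibleAlong (λ x → evalℤ f x ^ m) a h)) →
    HasDensity (VisibleAlong (λ x → evalℤ f x ^ m)) dec 1ℚ
theorem1p2 f (suc (suc n)) (+ suc l) _ (len , top , _) multiroot (suc (suc m)) _ dec =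
  -- The number passed for D is the predecessor of d · lc in the form to which (2 + n) * suc l
  -- computes, so the required equation is `refl`.
  let b , e , len-e , e≢0 , depressed = depressed-form f n l (l ℕ.+ suc n ℕ.* suc l) refl len top multiroot
  in density-1 dec (visibility-exceptions f e n (suc l) ((2 ℕ.+ n) ℕ.* suc l) b (s≤s z≤n) (s≤s z≤n) len-e e≢0 depressed m)
theorem1p2 f (suc (suc n)) (+ zero) _ (_ , _ , ℤ.+<+ ())
theorem1p2 f (suc zero) _ (s≤s ())
theorem1p2 f (suc (suc n)) (+ suc l) _ _ _ (suc zero) (s≤s ())
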